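{- Let $t$ be a term with $\vdash t:A$ in the sub-affine type system for $\lambda_{\text{coin}}$. If $t$ reduces to the distribution $D_1$ and $t$ reduces to the distribution $D_2$, then $D_1\equiv D_2$ (computational equivalence).
   Context: Terms of $\lambda_{\text{coin}}$: $t ::= x \mid \lambda x.t \mid t\,t \mid 1 \mid 0 \mid \mathsf{if}\ t\ \mathsf{then}\ t\ \mathsf{else}\ t \mid \mathsf{coin}$. One-step probabilistic reduction $t\to_p r$: base rules $(\lambda x.t)r \to_1 t[r/x]$, $\mathsf{if}\ 1\ \mathsf{then}\ t\ \mathsf{else}\ u \to_1 t$, $\mathsf{if}\ 0\ \mathsf{then}\ t\ \mathsf{else}\ u \to_1 u$, $\mathsf{coin}\to_{1/2}1$, $\mathsf{coin}\to_{1/2}0$, closed under all contexts (under $\lambda$, both sides of an application, and all three positions of an if-then-else). We write $t\to^*_{q} r$ if $t\to_{p_1}\cdots\to_{p_n} r$ with $q=\prod_i p_i$. A distribution of terms is a finite list $[(p_i,t_i)]_i$; reduction is lifted to distributions by choosing a redex in a term $t$ with one-step reducts $t\to_{q_j}t'_j$ ($\sum_j q_j=1$) and replacing $(p,t)$ by the entries $(pq_j,t'_j)$; a term $t$ reduces to $D$ if $D$ is obtained from $[(1,t)]$ by finitely many such steps. Equality $\sim$ of distributions means they assign the same total probability to each term. Types: $A ::= \mathbb{B} \mid A\to A$. Sub-affine type system (contexts written as $\Gamma,\Delta$ are required to be disjoint): $\Gamma,x:A\vdash x:A$; from $\Gamma,x:A\vdash t:B$ infer $\Gamma\vdash\lambda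 x.t:A\to B$; from $\Gamma\vdash t:A\to B$ and $\Delta\vdash r:A$ infer $\Gamma,\Delta\vdash tr:B$; $\Gamma\vdash 1:\mathbb{B}$, $\Gamma\vdash 0:\mathbb{B}$, $\Gamma\vdash\mathsf{coin}:\mathbb{B}$; from $\Gamma\vdash t:\mathbb{B}$, $\Delta\vdash u:A$, $\Delta\vdash v:A$ infer $\Gamma,\Delta\vdash \mathsf{if}\ t\ \mathsf{then}\ u\ \mathsf{else}\ v:A$ (the two branches share the same context). Elimination contexts: $C ::= \lozenge \mid C\,v$ where $v$ ranges over closed terms in normal form; $C\langle t\rangle$ denotes $C[t/\lozenge]$. $C$ is an elimination context of type $A$, written $C^A$, if for every $t$ with $\vdash t:A$ we have $\vdash C\langle t\rangle:\mathbb{B}$. Computational equivalence: for distributions $D_1=[(p_i,t_i)]_i$ and $D_2=[(q_j,r_j)]_j$ of closed terms of type $A$, $D_1\equiv D_2$ if for every $C^A$, reducing we get $C\langle t_i\rangle\to^*_{u_{ik}} b_{ik}$ and $C\langle r_j\rangle\to^*_{s_{jh}} c_{jh}$ with all $b_{ik},c_{jh}$ in normal form (the $[(u_{ik},b_{ik})]_k$ forming a reduction of $C\langle t_i\rangle$ to a distribution of normal forms, and likewise for $C\langle r_j\rangle$), such that $[(p_iu_{ik},b_{ik})]_{ik}\sim[(q_js_{jh},c_{jh})]_{jh}$. -}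

module Defs where

open import Data.Fin using (Fin; zero; suc)
open import Data.Fin.Properties using () renaming (_≟_ to _≟ᶠ_)
open import Data.List using (List; []; _∷_; [_]; _++_; map)
open import Data.List.Membership.Propositional using (_∈_)
open import Data.List.Membership.Propositional.Properties using (∈-map⁺)
open import Data.List.Relation.Unary.All as All using (All; []; _∷_)
open import Data.List.Relation.Unary.All.Properties using (++⁺; map⁺)
open import Data.List.Relation.Unary.Any using (here; there)
open import Data.Maybe using (Maybe; just; nothing)
open import Data.Nat using (ℕ; suc)
open import Data.Product using (∃; ∃₂; _×_; _,_; map₁; map₂)
open import Data.Rational using (ℚ; 0ℚ; 1ℚ; ½; _+_; _*_)
open import Data.Vec using (Vec; []; _∷_; lookup)
open import Relation.Binary.Construct.Closure.ReflexiveTransitive using (Star; ε; _◅_)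
open import Relation.Binary.Definitions using (DecidableEquality)
open import Relation.Binary.PropositionalEquality using (_≡_; refl; cong)
open import Relation.Nullary using (¬_; yes; no)
open import Relation.Nullary.Decidable using (map′; _×-dec_)

private
  variable
    m n : ℕ

-- Well-scoped de Bruijn terms, so that syntactic equality is α-equivalence.

infix  5 ƛ_
infix  6 if_then_else_
infixl 7 _·_

data Term (n : ℕ) : Set where
  var           : Fin n → Term n
  ƛ_            : Term (suc n) → Term n
  _·_           : Term n → Term n → Term n
  𝟏 𝟎           : Term n
  if_then_else_ : Term n → Term n → Term n → Term n
  coin          : Term n

extᵣ : (Fin m → Fin n) → Fin (suc m) → Fin (suc n)
extᵣ ρ zero    = zero
extᵣ ρ (suc x) = suc (ρ x)

rename : (Fin m → Fin n) → Term m → Term n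
rename ρ (var x)              = var (ρ x)
rename ρ (ƛ t)                = ƛ rename (extᵣ ρ) t
rename ρ (t · r)              = rename ρ t · rename ρ r
rename ρ 𝟏                    = 𝟏
rename ρ 𝟎                    = 𝟎
rename ρ (if t then u else v) = if rename ρ t then rename ρ u else rename ρ v
rename ρ coin                 = coin

extₛ : (Fin m → Term n) → Fin (suc m) → Term (suc n)
extₛ σ zero    = var zero
extₛ σ (suc x) = rename suc (σ x)

subst : (Fin m → Term n) → Term m → Term n
subst σ (var x)              = σ x
subst σ (ƛ t)                = ƛ subst (extₛ σ) t
subst σ (t · r)              = subst σ t · subst σ r
subst σ 𝟏                    = 𝟏
subst σ 𝟎                    = 𝟎
subst σ (if t then u else v) = if subst σ t then subst σ u else subst σ v
subst σ coin                 = coin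

sub₀ : Term n → Fin (suc n) → Term n
sub₀ r zero    = r
sub₀ r (suc x) = var x

_[_]₀ : Term (suc n) → Term n → Term n
t [ r ]₀ = subst (sub₀ r) t

infix 4 _≟_

_≟_ : DecidableEquality (Term n)
var x ≟ var y = map′ (cong var) (λ { refl → refl }) (x ≟ᶠ y)
ƛ t ≟ ƛ t′ = map′ (cong ƛ_) (λ { refl → refl }) (t ≟ t′)
(t · r) ≟ (t′ · r′) =
  map′ (λ { (refl , refl) → refl }) (λ { refl → refl , refl })
       (t ≟ t′ ×-dec r ≟ r′)
𝟏 ≟ 𝟏 = yes refl
𝟎 ≟ 𝟎 = yes refl
(if t then u else v) ≟ (if t′ then u′ else v′) =
  map′ (λ { (refl , refl , refl) → refl }) (λ { refl → refl , refl , refl })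
       (t ≟ t′ ×-dec (u ≟ u′ ×-dec v ≟ v′))
coin ≟ coin = yes refl
(var _) ≟ (ƛ _) = no λ ()
(var _) ≟ (_ · _) = no λ ()
(var _) ≟ 𝟏 = no λ ()
(var _) ≟ 𝟎 = no λ ()
(var _) ≟ (if _ then _ else _) = no λ ()
(var _) ≟ coin = no λ ()
(ƛ _) ≟ (var _) = no λ ()
(ƛ _) ≟ (_ · _) = no λ ()
(ƛ _) ≟ 𝟏 = no λ ()
(ƛ _) ≟ 𝟎 = no λ ()
(ƛ _) ≟ (if _ then _ else _) = no λ ()
(ƛ _) ≟ coin = no λ ()
(_ · _) ≟ (var _) = no λ ()
(_ · _) ≟ (ƛ _) = no λ ()
(_ · _) ≟ 𝟏 = no λ ()
(_ · _) ≟ 𝟎 = no λ ()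
(_ · _) ≟ (if _ then _ else _) = no λ ()
(_ · _) ≟ coin = no λ ()
𝟏 ≟ (var _) = no λ ()
𝟏 ≟ (ƛ _) = no λ ()
𝟏 ≟ (_ · _) = no λ ()
𝟏 ≟ 𝟎 = no λ ()
𝟏 ≟ (if _ then _ else _) = no λ ()
𝟏 ≟ coin = no λ ()
𝟎 ≟ (var _) = no λ ()
𝟎 ≟ (ƛ _) = no λ ()
𝟎 ≟ (_ · _) = no λ ()
𝟎 ≟ 𝟏 = no λ ()
𝟎 ≟ (if _ then _ else _) = no λ ()
𝟎 ≟ coin = no λ ()
(if _ then _ else _) ≟ (var _) = no λ ()
(if _ then _ else _) ≟ (ƛ _) = no λ ()
(if _ then _ else _) ≟ (_ · _) = no λ ()
(if _ then _ else _) ≟ 𝟏 = no λ ()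
(if _ then _ else _) ≟ 𝟎 = no λ ()
(if _ then _ else _) ≟ coin = no λ ()
coin ≟ (var _) = no λ ()
coin ≟ (ƛ _) = no λ ()
coin ≟ (_ · _) = no λ ()
coin ≟ 𝟏 = no λ ()
coin ≟ 𝟎 = no λ ()
coin ≟ (if _ then _ else _) = no λ ()

infix 4 _⟶[_]_ _⟶*[_]_

data _⟶[_]_ {n : ℕ} : Term n → ℚ → Term n → Set where
  β     : ∀ {t r} → (ƛ t) · r ⟶[ 1ℚ ] t [ r ]₀
  if-𝟏  : ∀ {t u} → if 𝟏 then t else u ⟶[ 1ℚ ] t
  if-𝟎  : ∀ {t u} → if 𝟎 then t else u ⟶[ 1ℚ ] u
  coin₁ : coin ⟶[ ½ ] 𝟏
  coin₀ : coin ⟶[ ½ ] 𝟎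
  ξ-ƛ   : ∀ {p t t′} → t ⟶[ p ] t′ → ƛ t ⟶[ p ] ƛ t′
  ξ-·ˡ  : ∀ {p t t′ r} → t ⟶[ p ] t′ → t · r ⟶[ p ] t′ · r
  ξ-·ʳ  : ∀ {p t r r′} → r ⟶[ p ] r′ → t · r ⟶[ p ] t · r′
  ξ-if  : ∀ {p t t′ u v} → t ⟶[ p ] t′ →
          if t then u else v ⟶[ p ] if t′ then u else v
  ξ-then : ∀ {p t u u′ v} → u ⟶[ p ] u′ →
          if t then u else v ⟶[ p ] if t then u′ else v
  ξ-else : ∀ {p t u v v′} → v ⟶[ p ] v′ →
          if t then u else v ⟶[ p ] if t then u else v′

data _⟶*[_]_ {n : ℕ} (t : Term n) : ℚ → Term n → Set where
  done : t ⟶*[ 1ℚ ] t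
  _▻_  : ∀ {p q r s} → t ⟶*[ p ] r → r ⟶[ q ] s → t ⟶*[ p * q ] s

Normal : Term n → Set
Normal t = ∀ p r → ¬ (t ⟶[ p ] r)

Dist : ℕ → Set
Dist n = List (ℚ × Term n)

scale : ℚ → Dist n → Dist n
scale p = map (map₁ (p *_))

mapᵈ : (Term m → Term n) → Dist m → Dist n
mapᵈ f = map (map₂ f)

prob : Dist n → Term n → ℚ
prob []            t = 0ℚ
prob ((p , r) ∷ D) t with r ≟ t
... | yes _ = p + prob D t
... | no  _ = prob D t

infix 4 _∼_

_∼_ : Dist n → Dist n → Set
D₁ ∼ D₂ = ∀ t → prob D₁ t ≡ prob D₂ t

-- A derivation of t ⟹ E is an occurrence of a redex in t, and E lists all
-- the reducts of t obtained by contracting that occurrence; see ⟹-sound and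
-- ⟹-complete for the agreement with _⟶[_]_.

infix 4 _⟹_ _⟶ᵈ_ _↠_

data _⟹_ : Term n → Dist n → Set where
  β     : {t : Term (suc n)} {r : Term n} → (ƛ t) · r ⟹ [ 1ℚ , t [ r ]₀ ]
  if-𝟏  : {t u : Term n} → if 𝟏 then t else u ⟹ [ 1ℚ , t ]
  if-𝟎  : {t u : Term n} → if 𝟎 then t else u ⟹ [ 1ℚ , u ]
  coin  : coin {n} ⟹ (½ , 𝟏) ∷ (½ , 𝟎) ∷ []
  ξ-ƛ   : {t : Term (suc n)} {E : Dist (suc n)} →
          t ⟹ E → ƛ t ⟹ mapᵈ ƛ_ E
  ξ-·ˡ  : {t r : Term n} {E : Dist n} →
          t ⟹ E → t · r ⟹ mapᵈ (_· r) E
  ξ-·ʳ  : {t r : Term n} {E : Dist n} →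
          r ⟹ E → t · r ⟹ mapᵈ (t ·_) E
  ξ-if  : {t u v : Term n} {E : Dist n} →
          t ⟹ E → if t then u else v ⟹ mapᵈ (if_then u else v) E
  ξ-then : {t u v : Term n} {E : Dist n} →
          u ⟹ E → if t then u else v ⟹ mapᵈ (if t then_else v) E
  ξ-else : {t u v : Term n} {E : Dist n} →
          v ⟹ E → if t then u else v ⟹ mapᵈ (if t then u else_) E

data _⟶ᵈ_ {n : ℕ} : Dist n → Dist n → Set where
  here  : ∀ {p t E D} → t ⟹ E → (p , t) ∷ D ⟶ᵈ scale p E ++ D
  there : ∀ {e D D′} → D ⟶ᵈ D′ → e ∷ D ⟶ᵈ e ∷ D′

_↠_ : Term n → Dist n → Set
t ↠ D = Star _⟶ᵈ_ [ 1ℚ , t ] D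

⟹-sound : {t : Term n} {E : Dist n} →
          t ⟹ E → All (λ (p , r) → t ⟶[ p ] r) E
⟹-sound β          = β ∷ []
⟹-sound if-𝟏       = if-𝟏 ∷ []
⟹-sound if-𝟎       = if-𝟎 ∷ []
⟹-sound coin       = coin₁ ∷ coin₀ ∷ []
⟹-sound (ξ-ƛ s)    = map⁺ (All.map ξ-ƛ (⟹-sound s))
⟹-sound (ξ-·ˡ s)   = map⁺ (All.map ξ-·ˡ (⟹-sound s))
⟹-sound (ξ-·ʳ s)   = map⁺ (All.map ξ-·ʳ (⟹-sound s))
⟹-sound (ξ-if s)   = map⁺ (All.map ξ-if (⟹-sound s))
⟹-sound (ξ-then s) = map⁺ (All.map ξ-then (⟹-sound s))
⟹-sound (ξ-else s) = map⁺ (All.map ξ-else (⟹-sound s))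

⟹-complete : ∀ {p} {t r : Term n} →
             t ⟶[ p ] r → ∃ λ E → t ⟹ E × (p , r) ∈ E
⟹-complete β     = _ , β , here refl
⟹-complete if-𝟏  = _ , if-𝟏 , here refl
⟹-complete if-𝟎  = _ , if-𝟎 , here refl
⟹-complete coin₁ = _ , coin , here refl
⟹-complete coin₀ = _ , coin , there (here refl)
⟹-complete (ξ-ƛ s)    = let _ , h , i = ⟹-complete s in _ , ξ-ƛ h , ∈-map⁺ _ i
⟹-complete (ξ-·ˡ s)   = let _ , h , i = ⟹-complete s in _ , ξ-·ˡ h , ∈-map⁺ _ i
⟹-complete (ξ-·ʳ s)   = let _ , h , i = ⟹-complete s in _ , ξ-·ʳ h , ∈-map⁺ _ i
⟹-complete (ξ-if s)   = let _ , h , i = ⟹-complete s in _ , ξ-if h , ∈-map⁺ _ i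
⟹-complete (ξ-then s) = let _ , h , i = ⟹-complete s in _ , ξ-then h , ∈-map⁺ _ i
⟹-complete (ξ-else s) = let _ , h , i = ⟹-complete s in _ , ξ-else h , ∈-map⁺ _ i

↠-paths : {t : Term n} {D : Dist n} →
          t ↠ D → All (λ (q , r) → t ⟶*[ q ] r) D
↠-paths {n} {t} = go (done ∷ [])
  where
  Paths : Dist n → Set
  Paths = All (λ (q , r) → t ⟶*[ q ] r)

  step : ∀ {D D′} → Paths D → D ⟶ᵈ D′ → Paths D′
  step (π ∷ πs) (here s)  = ++⁺ (map⁺ (All.map (π ▻_) (⟹-sound s))) πs
  step (π ∷ πs) (there s) = π ∷ step πs s

  go : ∀ {D D′} → Paths D → Star _⟶ᵈ_ D D′ → Paths D′
  go πs ε        = πs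
  go πs (s ◅ ss) = go (step πs s) ss

infixr 7 _⇒_

data Type : Set where
  𝔹   : Type
  _⇒_ : Type → Type → Type

-- A typing context is a finite partial map from the variables in scope to
-- types: an entry `nothing` means that the variable is not in the context.

Ctx : ℕ → Set
Ctx n = Vec (Maybe Type) n

-- Γ ⨟ Δ ≔ Θ: the contexts Γ and Δ have disjoint domains and union Θ.

infix 4 _⨟_≔_ _⊢_⦂_

data _⨟_≔_ : Ctx n → Ctx n → Ctx n → Set where
  []    : [] ⨟ [] ≔ []
  none  : {Γ Δ Θ : Ctx n} → Γ ⨟ Δ ≔ Θ →
          nothing ∷ Γ ⨟ nothing ∷ Δ ≔ nothing ∷ Θ
  left  : ∀ {A} {Γ Δ Θ : Ctx n} → Γ ⨟ Δ ≔ Θ →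
          just A ∷ Γ ⨟ nothing ∷ Δ ≔ just A ∷ Θ
  right : ∀ {A} {Γ Δ Θ : Ctx n} → Γ ⨟ Δ ≔ Θ →
          nothing ∷ Γ ⨟ just A ∷ Δ ≔ just A ∷ Θ

data _⊢_⦂_ {n : ℕ} : Ctx n → Term n → Type → Set where
  ⊢var  : ∀ {Γ x A} → lookup Γ x ≡ just A → Γ ⊢ var x ⦂ A
  ⊢ƛ    : ∀ {Γ t A B} → just A ∷ Γ ⊢ t ⦂ B → Γ ⊢ ƛ t ⦂ A ⇒ B
  ⊢·    : ∀ {Γ Δ Θ t r A B} → Γ ⨟ Δ ≔ Θ →
          Γ ⊢ t ⦂ A ⇒ B → Δ ⊢ r ⦂ A → Θ ⊢ t · r ⦂ B
  ⊢𝟏    : ∀ {Γ} → Γ ⊢ 𝟏 ⦂ 𝔹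
  ⊢𝟎    : ∀ {Γ} → Γ ⊢ 𝟎 ⦂ 𝔹
  ⊢coin : ∀ {Γ} → Γ ⊢ coin ⦂ 𝔹
  ⊢if   : ∀ {Γ Δ Θ t u v A} → Γ ⨟ Δ ≔ Θ →
          Γ ⊢ t ⦂ 𝔹 → Δ ⊢ u ⦂ A → Δ ⊢ v ⦂ A → Θ ⊢ if t then u else v ⦂ A

data ElimCtx : Set where
  ◊   : ElimCtx
  app : ElimCtx → (v : Term 0) → Normal v → ElimCtx

_⟨_⟩ : ElimCtx → Term 0 → Term 0
◊         ⟨ t ⟩ = t
app C v _ ⟨ t ⟩ = C ⟨ t ⟩ · v

_HasType_ : ElimCtx → Type → Set
C HasType A = ∀ t → [] ⊢ t ⦂ A → [] ⊢ C ⟨ t ⟩ ⦂ 𝔹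

-- Evaluates C [(pᵢ , tᵢ)]ᵢ F: for each i there is a distribution of normal
-- forms [(uᵢₖ , bᵢₖ)]ₖ to which C⟨tᵢ⟩ reduces, and F = [(pᵢ uᵢₖ , bᵢₖ)]ᵢₖ.
-- The individual paths from C⟨tᵢ⟩ to bᵢₖ are given by ↠-paths.

data Evaluates (C : ElimCtx) : Dist 0 → Dist 0 → Set where
  []   : Evaluates C [] []
  cons : ∀ {p t D E F} →
         C ⟨ t ⟩ ↠ E → All (λ (_ , b) → Normal b) E →
         Evaluates C D F → Evaluates C ((p , t) ∷ D) (scale p E ++ F)

TypedDist : Type → Dist 0 → Set
TypedDist A = All (λ (_ , t) → [] ⊢ t ⦂ A)

infix 4 _≡[_]_

-- The relation is only defined between distributions of closed terms of
-- type A; the first two fields record this.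

record _≡[_]_ (D₁ : Dist 0) (A : Type) (D₂ : Dist 0) : Set where
  field
    typedˡ : TypedDist A D₁
    typedʳ : TypedDist A D₂
    equiv  : ∀ C → C HasType A →
             ∃₂ λ F₁ F₂ → Evaluates C D₁ F₁ × Evaluates C D₂ F₂ × F₁ ∼ F₂

{-# OPTIONS --safe #-}
module Submission where

-- Interpret 𝔹 as ℚ (the probability of 𝟏), A ⇒ B as functions, and a conditional
-- as the convex combination of its branches weighted by its condition.  Because
-- the subterms of an application or of a conditional use disjoint variables,
-- denotations preserve midpoints in each variable separately.  Hence
-- contracting a coin anywhere, even in the argument of a function or under a
-- binder, splits the denotation into the midpoint of the two reducts, and the
-- other rules leave it unchanged.  So the expected denotation of a distribution
-- is invariant under reduction.  Now C⟨t⟩ reduces to C⟨D₁⟩ and to C⟨D₂⟩, and these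
-- reduce to distributions of booleans, in which the expectation determines all
-- the probabilities.

open import Algebra.Properties.CommutativeSemigroup using (interchange)
open import Data.Empty using (⊥)
open import Data.Fin using (Fin; zero; suc)
open import Data.List using ([]; _∷_; [_]; _++_)
open import Data.List.Properties using (map-++; map-id; map-∘; map-cong; ++-assoc; ++-identityʳ)
open import Data.List.Relation.Unary.All as All using (All; []; _∷_)
open import Data.List.Relation.Unary.All.Properties using (++⁺; map⁺)
open import Data.Maybe using (just; nothing)
open import Data.Nat as ℕ using (ℕ; suc)
open import Data.Nat.Induction using (<-wellFounded)
import Data.Nat.Properties as ℕ
open import Data.Product using (_×_; _,_; proj₁; proj₂; ∃; map₁; map₂)
open import Data.Rational using (ℚ; 0ℚ; 1ℚ; ½; _+_; _*_; _-_)
import Data.Rational.Properties as ℚ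
open import Data.Rational.Solver using (module +-*-Solver)
open import Data.Sum using (_⊎_; inj₁; inj₂)
open import Data.Unit using (⊤; tt)
open import Data.Vec using ([]; _∷_; lookup)
open import Function using (_∘_)
open import Induction.WellFounded using (Acc; acc)
open import Relation.Binary.Construct.Closure.ReflexiveTransitive using (Star; ε; _◅_; _◅◅_; gmap)
open import Relation.Binary.PropositionalEquality as ≡ using (_≡_; refl; sym; trans; cong; cong₂; module ≡-Reasoning)
open import Relation.Nullary using (yes; no)
open import Defs

open +-*-Solver using (solve; con; _:=_; _:+_; _:*_; _:-_)

private
  variable
    m n : ℕ
    A B : Type
    Γ Γ₁ Γ₂ Δ Θ : Ctx n

-- The convex model

⟦_⟧ᵗ : Type → Set
⟦ 𝔹 ⟧ᵗ     = ℚ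
⟦ A ⇒ B ⟧ᵗ = ⟦ A ⟧ᵗ → ⟦ B ⟧ᵗ

mix : ∀ A → ℚ → ⟦ A ⟧ᵗ → ⟦ A ⟧ᵗ → ⟦ A ⟧ᵗ
mix 𝔹       p a b = p * a + (1ℚ - p) * b
mix (A ⇒ B) p f g = λ a → mix B p (f a) (g a)

-- Eq is only a partial equivalence relation: its domain consists of the functions
-- that respect it and preserve midpoints, hereditarily.
mutual
  Eq : ∀ A → ⟦ A ⟧ᵗ → ⟦ A ⟧ᵗ → Set
  Eq 𝔹       a b = a ≡ b
  Eq (A ⇒ B) f g = (∀ {a b} → Eq A a b → Eq B (f a) (g b)) × PreservesMid A B f × PreservesMid A B g

  -- Mid A a b c: a is the midpoint of b and c.
  Mid : ∀ A → ⟦ A ⟧ᵗ → ⟦ A ⟧ᵗ → ⟦ A ⟧ᵗ → Set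
  Mid 𝔹       a b c = a ≡ ½ * b + ½ * c
  Mid (A ⇒ B) f g h = (Eq (A ⇒ B) f f × Eq (A ⇒ B) g g × Eq (A ⇒ B) h h) ×
                      (∀ {a} → Eq A a a → Mid B (f a) (g a) (h a))

  PreservesMid : ∀ A B → (⟦ A ⟧ᵗ → ⟦ B ⟧ᵗ) → Set
  PreservesMid A B f = ∀ {a b c} → Mid A a b c → Mid B (f a) (f b) (f c)

Eq-sym : ∀ A {a b} → Eq A a b → Eq A b a
Eq-sym 𝔹       e            = sym e
Eq-sym (A ⇒ B) (e , mf , mg) = (λ x → Eq-sym B (e (Eq-sym A x))) , mg , mf

-- At a function type the second function is applied to related arguments built from the right-hand
-- one alone, which is related to itself by symmetry and transitivity one type lower.
Eq-trans : ∀ A {a b c} → Eq A a b → Eq A b c → Eq A a c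
Eq-trans 𝔹       e e′ = trans e e′
Eq-trans (A ⇒ B) (e , mf , _) (e′ , _ , mh) =
  (λ x → Eq-trans B (e x) (e′ (Eq-trans A (Eq-sym A x) x))) , mf , mh

Eq-reflˡ : ∀ A {a b} → Eq A a b → Eq A a a
Eq-reflˡ A e = Eq-trans A e (Eq-sym A e)

Eq-reflʳ : ∀ A {a b} → Eq A a b → Eq A b b
Eq-reflʳ A e = Eq-trans A (Eq-sym A e) e

-- At function types `Mid` carries these facts explicitly: its pointwise clause alone does not place
-- the three functions in the domain of `Eq`.
Mid⇒Eq : ∀ A {a b c} → Mid A a b c → Eq A a a × Eq A b b × Eq A c c
Mid⇒Eq 𝔹       _       = refl , refl , refl
Mid⇒Eq (A ⇒ B) (e , _) = e

Mid-resp : ∀ A {a a′ b b′ c c′} → Eq A a a′ → Eq A b b′ → Eq A c c′ →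
           Mid A a b c → Mid A a′ b′ c′
Mid-resp 𝔹       refl refl refl m = m
Mid-resp (A ⇒ B) e e′ e″ (_ , m) =
  (Eq-reflʳ (A ⇒ B) e , Eq-reflʳ (A ⇒ B) e′ , Eq-reflʳ (A ⇒ B) e″) ,
  λ x → Mid-resp B (proj₁ e x) (proj₁ e′ x) (proj₁ e″ x) (m x)

Mid-refl : ∀ A {a} → Eq A a a → Mid A a a a
Mid-refl 𝔹 {a} _ = solve 1 (λ a → a := con ½ :* a :+ con ½ :* a) refl a
Mid-refl (A ⇒ B) e = (e , e , e) , λ x → Mid-refl B (proj₁ e x)

-- With the weight fixed, a convex combination commutes with midpoints. The proof is mutual with
-- `Eq-mix` because `Eq` at a function type demands midpoint preservation, while `Mid` there demands
-- membership in the domain of `Eq`.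
Mid-mix : ∀ A p {a a₁ a₂ b b₁ b₂} → Mid A a a₁ a₂ → Mid A b b₁ b₂ →
          Mid A (mix A p a b) (mix A p a₁ b₁) (mix A p a₂ b₂)
Eq-mix : ∀ A {p p′ a a′ b b′} → p ≡ p′ → Eq A a a′ → Eq A b b′ →
         Eq A (mix A p a b) (mix A p′ a′ b′)

Mid-mix 𝔹 p {a₁ = a₁} {a₂} {b₁ = b₁} {b₂} refl refl =
  solve 5 (λ p a₁ a₂ b₁ b₂ →
             p :* (con ½ :* a₁ :+ con ½ :* a₂) :+ (con 1ℚ :- p) :* (con ½ :* b₁ :+ con ½ :* b₂) :=
             con ½ :* (p :* a₁ :+ (con 1ℚ :- p) :* b₁) :+ con ½ :* (p :* a₂ :+ (con 1ℚ :- p) :* b₂))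
          refl p a₁ a₂ b₁ b₂
Mid-mix (A ⇒ B) p ((ea , ea₁ , ea₂) , ma) ((eb , eb₁ , eb₂) , mb) =
  (Eq-mix (A ⇒ B) refl ea eb , Eq-mix (A ⇒ B) refl ea₁ eb₁ , Eq-mix (A ⇒ B) refl ea₂ eb₂) ,
  λ x → Mid-mix B p (ma x) (mb x)

Eq-mix 𝔹 refl refl refl = refl
Eq-mix (A ⇒ B) {p} refl (e , mf , mf′) (e′ , mg , mg′) =
  (λ x → Eq-mix B refl (e x) (e′ x)) ,
  (λ m → Mid-mix B p (mf m) (mg m)) ,
  (λ m → Mid-mix B p (mf′ m) (mg′ m))

-- The other half of affinity: the weight moves and the branches stay. Moving both at once would
-- give a quadratic expression, but a condition and its branches have disjoint contexts.
Mid-mix-weight : ∀ A {p q r a b} → p ≡ ½ * q + ½ * r → Eq A a a → Eq A b b →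
                 Mid A (mix A p a b) (mix A q a b) (mix A r a b)
Mid-mix-weight 𝔹 {q = q} {r} {a} {b} refl _ _ =
  solve 4 (λ q r a b →
             (con ½ :* q :+ con ½ :* r) :* a :+ (con 1ℚ :- (con ½ :* q :+ con ½ :* r)) :* b :=
             con ½ :* (q :* a :+ (con 1ℚ :- q) :* b) :+ con ½ :* (r :* a :+ (con 1ℚ :- r) :* b))
          refl q r a b
Mid-mix-weight (A ⇒ B) eq e e′ =
  (Eq-mix (A ⇒ B) refl e e′ , Eq-mix (A ⇒ B) refl e e′ , Eq-mix (A ⇒ B) refl e e′) ,
  λ x → Mid-mix-weight B eq (proj₁ e x) (proj₁ e′ x)

mix-1 : ∀ A {a b} → Eq A a a → Eq A b b → Eq A (mix A 1ℚ a b) a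
mix-1 𝔹 {a} {b} _ _ =
  solve 2 (λ a b → con 1ℚ :* a :+ (con 1ℚ :- con 1ℚ) :* b := a) refl a b
mix-1 (A ⇒ B) e@(f , m , _) e′@(g , _) =
  (λ x → Eq-trans B (mix-1 B (Eq-reflˡ B (f x)) (g (Eq-reflˡ A x))) (f x)) ,
  -- The mixture itself preserves midpoints, as recorded in its own self-relatedness.
  proj₁ (proj₂ (Eq-mix (A ⇒ B) {1ℚ} refl e e′)) , m

mix-0 : ∀ A {a b} → Eq A a a → Eq A b b → Eq A (mix A 0ℚ a b) b
mix-0 𝔹 {a} {b} _ _ =
  solve 2 (λ a b → con 0ℚ :* a :+ (con 1ℚ :- con 0ℚ) :* b := b) refl a b
mix-0 (A ⇒ B) e@(f , _) e′@(g , m , _) =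
  (λ x → Eq-trans B (mix-0 B (f (Eq-reflˡ A x)) (Eq-reflˡ B (g x))) (g x)) ,
  proj₁ (proj₂ (Eq-mix (A ⇒ B) {0ℚ} refl e e′)) , m

-- Environments and the interpretation of typing derivations

Env : Ctx n → Set
Env []            = ⊤
Env (nothing ∷ Γ) = Env Γ
Env (just A ∷ Γ)  = ⟦ A ⟧ᵗ × Env Γ

EqEnv : (Γ : Ctx n) → Env Γ → Env Γ → Set
EqEnv []            _       _         = ⊤
EqEnv (nothing ∷ Γ) γ       γ′        = EqEnv Γ γ γ′
EqEnv (just A ∷ Γ)  (a , γ) (a′ , γ′) = Eq A a a′ × EqEnv Γ γ γ′

-- The environments agree up to Eq except at one variable, where the first
-- is the midpoint of the other two.
MidEnv : (Γ : Ctx n) → Env Γ → Env Γ → Env Γ → Set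
MidEnv []            _       _        _        = ⊥
MidEnv (nothing ∷ Γ) γ       γ₁       γ₂       = MidEnv Γ γ γ₁ γ₂
MidEnv (just A ∷ Γ)  (a , γ) (a₁ , γ₁) (a₂ , γ₂) =
  (Mid A a a₁ a₂ × EqEnv Γ γ γ₁ × EqEnv Γ γ γ₂) ⊎
  ((Eq A a a₁ × Eq A a a₂) × MidEnv Γ γ γ₁ γ₂)

EqEnv-sym : (Γ : Ctx n) → ∀ {γ γ′} → EqEnv Γ γ γ′ → EqEnv Γ γ′ γ
EqEnv-sym []            _       = tt
EqEnv-sym (nothing ∷ Γ) e       = EqEnv-sym Γ e
EqEnv-sym (just A ∷ Γ)  (x , e) = Eq-sym A x , EqEnv-sym Γ e

EqEnv-reflˡ : (Γ : Ctx n) → ∀ {γ γ′} → EqEnv Γ γ γ′ → EqEnv Γ γ γ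
EqEnv-reflˡ []            _       = tt
EqEnv-reflˡ (nothing ∷ Γ) e       = EqEnv-reflˡ Γ e
EqEnv-reflˡ (just A ∷ Γ)  (x , e) = Eq-reflˡ A x , EqEnv-reflˡ Γ e

EqEnv-reflʳ : (Γ : Ctx n) → ∀ {γ γ′} → EqEnv Γ γ γ′ → EqEnv Γ γ′ γ′
EqEnv-reflʳ Γ e = EqEnv-reflˡ Γ (EqEnv-sym Γ e)

MidEnv⇒EqEnv : (Γ : Ctx n) → ∀ {γ γ₁ γ₂} → MidEnv Γ γ γ₁ γ₂ →
               EqEnv Γ γ γ × EqEnv Γ γ₁ γ₁ × EqEnv Γ γ₂ γ₂
MidEnv⇒EqEnv (nothing ∷ Γ) m = MidEnv⇒EqEnv Γ m
MidEnv⇒EqEnv (just A ∷ Γ) (inj₁ (m , e₁ , e₂)) =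
  let x , x₁ , x₂ = Mid⇒Eq A m
  in (x , EqEnv-reflˡ Γ e₁) , (x₁ , EqEnv-reflʳ Γ e₁) , (x₂ , EqEnv-reflʳ Γ e₂)
MidEnv⇒EqEnv (just A ∷ Γ) (inj₂ ((x₁ , x₂) , m)) =
  let e , e₁ , e₂ = MidEnv⇒EqEnv Γ m
  in (Eq-reflˡ A x₁ , e) , (Eq-reflʳ A x₁ , e₁) , (Eq-reflʳ A x₂ , e₂)

splitˡ : Γ ⨟ Δ ≔ Θ → Env Θ → Env Γ
splitˡ []        _       = tt
splitˡ (none s)  γ       = splitˡ s γ
splitˡ (left s)  (a , γ) = a , splitˡ s γ
splitˡ (right s) (_ , γ) = splitˡ s γ

splitʳ : Γ ⨟ Δ ≔ Θ → Env Θ → Env Δ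
splitʳ []        _       = tt
splitʳ (none s)  γ       = splitʳ s γ
splitʳ (left s)  (_ , γ) = splitʳ s γ
splitʳ (right s) (a , γ) = a , splitʳ s γ

EqEnv-splitˡ : (s : Γ ⨟ Δ ≔ Θ) → ∀ {γ γ′} → EqEnv Θ γ γ′ → EqEnv Γ (splitˡ s γ) (splitˡ s γ′)
EqEnv-splitˡ []        _       = tt
EqEnv-splitˡ (none s)  e       = EqEnv-splitˡ s e
EqEnv-splitˡ (left s)  (x , e) = x , EqEnv-splitˡ s e
EqEnv-splitˡ (right s) (_ , e) = EqEnv-splitˡ s e

EqEnv-splitʳ : (s : Γ ⨟ Δ ≔ Θ) → ∀ {γ γ′} → EqEnv Θ γ γ′ → EqEnv Δ (splitʳ s γ) (splitʳ s γ′)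
EqEnv-splitʳ []        _       = tt
EqEnv-splitʳ (none s)  e       = EqEnv-splitʳ s e
EqEnv-splitʳ (left s)  (_ , e) = EqEnv-splitʳ s e
EqEnv-splitʳ (right s) (x , e) = x , EqEnv-splitʳ s e

-- Disjointness at work: the distinguished variable goes to one side only, so the other side sees
-- three environments that agree up to `Eq`.
MidEnv-split : (s : Γ ⨟ Δ ≔ Θ) → ∀ {γ γ₁ γ₂} → MidEnv Θ γ γ₁ γ₂ →
  (MidEnv Γ (splitˡ s γ) (splitˡ s γ₁) (splitˡ s γ₂) ×
   EqEnv Δ (splitʳ s γ) (splitʳ s γ₁) × EqEnv Δ (splitʳ s γ) (splitʳ s γ₂)) ⊎
  (MidEnv Δ (splitʳ s γ) (splitʳ s γ₁) (splitʳ s γ₂) ×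
   EqEnv Γ (splitˡ s γ) (splitˡ s γ₁) × EqEnv Γ (splitˡ s γ) (splitˡ s γ₂))
MidEnv-split (none s) m = MidEnv-split s m
MidEnv-split (left s) (inj₁ (m , e₁ , e₂)) =
  inj₁ (inj₁ (m , EqEnv-splitˡ s e₁ , EqEnv-splitˡ s e₂) , EqEnv-splitʳ s e₁ , EqEnv-splitʳ s e₂)
MidEnv-split (left s) (inj₂ (x@(x₁ , x₂) , m)) with MidEnv-split s m
... | inj₁ (mˡ , es)      = inj₁ (inj₂ (x , mˡ) , es)
... | inj₂ (mʳ , e₁ , e₂) = inj₂ (mʳ , (x₁ , e₁) , (x₂ , e₂))
MidEnv-split (right s) (inj₁ (m , e₁ , e₂)) =
  inj₂ (inj₁ (m , EqEnv-splitʳ s e₁ , EqEnv-splitʳ s e₂) , EqEnv-splitˡ s e₁ , EqEnv-splitˡ s e₂)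
MidEnv-split (right s) (inj₂ (x@(x₁ , x₂) , m)) with MidEnv-split s m
... | inj₁ (mˡ , e₁ , e₂) = inj₁ (mˡ , (x₁ , e₁) , (x₂ , e₂))
... | inj₂ (mʳ , es)      = inj₂ (inj₂ (x , mʳ) , es)

lookupᵉ : (Γ : Ctx n) (x : Fin n) → lookup Γ x ≡ just A → Env Γ → ⟦ A ⟧ᵗ
lookupᵉ (just A ∷ Γ)  zero    refl (a , _) = a
lookupᵉ (nothing ∷ Γ) (suc x) eq   γ       = lookupᵉ Γ x eq γ
lookupᵉ (just _ ∷ Γ)  (suc x) eq   (_ , γ) = lookupᵉ Γ x eq γ

Eq-lookup : (Γ : Ctx n) (x : Fin n) (eq : lookup Γ x ≡ just A) → ∀ {γ γ′} →
            EqEnv Γ γ γ′ → Eq A (lookupᵉ Γ x eq γ) (lookupᵉ Γ x eq γ′)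
Eq-lookup (just A ∷ Γ)  zero    refl (e , _) = e
Eq-lookup (nothing ∷ Γ) (suc x) eq   e       = Eq-lookup Γ x eq e
Eq-lookup (just _ ∷ Γ)  (suc x) eq   (_ , e) = Eq-lookup Γ x eq e

Mid-const : ∀ A {a b c} → Eq A a b → Eq A a c → Mid A a b c
Mid-const A e e′ = Mid-resp A (Eq-reflˡ A e) e e′ (Mid-refl A (Eq-reflˡ A e))

Mid-lookup : (Γ : Ctx n) (x : Fin n) (eq : lookup Γ x ≡ just A) → ∀ {γ γ₁ γ₂} →
             MidEnv Γ γ γ₁ γ₂ →
             Mid A (lookupᵉ Γ x eq γ) (lookupᵉ Γ x eq γ₁) (lookupᵉ Γ x eq γ₂)
Mid-lookup (just A ∷ Γ)  zero    refl (inj₁ (m , _))         = m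
Mid-lookup (just A ∷ Γ)  zero    refl (inj₂ ((e₁ , e₂) , _)) = Mid-const A e₁ e₂
Mid-lookup (nothing ∷ Γ) (suc x) eq   m                      = Mid-lookup Γ x eq m
Mid-lookup (just _ ∷ Γ)  (suc x) eq   (inj₁ (_ , e₁ , e₂))   =
  Mid-const _ (Eq-lookup Γ x eq e₁) (Eq-lookup Γ x eq e₂)
Mid-lookup (just _ ∷ Γ)  (suc x) eq   (inj₂ (_ , m))         = Mid-lookup Γ x eq m

⟦_⟧ : {Γ : Ctx n} {t : Term n} → Γ ⊢ t ⦂ A → Env Γ → ⟦ A ⟧ᵗ
⟦ ⊢var {Γ = Γ} {x} eq ⟧ γ = lookupᵉ Γ x eq γ
⟦ ⊢ƛ d ⟧ γ                = λ a → ⟦ d ⟧ (a , γ)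
⟦ ⊢· s d e ⟧ γ            = ⟦ d ⟧ (splitˡ s γ) (⟦ e ⟧ (splitʳ s γ))
⟦ ⊢𝟏 ⟧ γ                  = 1ℚ
⟦ ⊢𝟎 ⟧ γ                  = 0ℚ
⟦ ⊢coin ⟧ γ               = ½
⟦ ⊢if {A = A} s d e f ⟧ γ = mix A (⟦ d ⟧ (splitˡ s γ)) (⟦ e ⟧ (splitʳ s γ)) (⟦ f ⟧ (splitʳ s γ))

-- The function moves and the argument stays, which is the pointwise clause of `Mid`.
Mid-app : ∀ A B {f f₁ f₂ a a₁ a₂} → Mid (A ⇒ B) f f₁ f₂ → Eq A a a₁ → Eq A a a₂ →
          Mid B (f a) (f₁ a₁) (f₂ a₂)
Mid-app A B ((e , e₁ , e₂) , m) x₁ x₂ =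
  Mid-resp B (proj₁ e (Eq-reflˡ A x₁)) (proj₁ e₁ x₁) (proj₁ e₂ x₂) (m (Eq-reflˡ A x₁))

-- The argument moves and the function stays, which is where the `PreservesMid` component of `Eq` is
-- spent.
Mid-arg : ∀ A B {f f₁ f₂ a a₁ a₂} → Eq (A ⇒ B) f f₁ → Eq (A ⇒ B) f f₂ → Mid A a a₁ a₂ →
          Mid B (f a) (f₁ a₁) (f₂ a₂)
Mid-arg A B e₁ e₂ m =
  let x , x₁ , x₂ = Mid⇒Eq A m
  in Mid-resp B (proj₁ (Eq-reflˡ (A ⇒ B) e₁) x) (proj₁ e₁ x₁) (proj₁ e₂ x₂) (proj₁ (proj₂ e₁) m)

-- Multi-affinity: since the two sides of a split share no variable, a
-- midpoint in one variable is seen by only one of the two subterms.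
Eq-⟦⟧ : {Γ : Ctx n} {t : Term n} (d : Γ ⊢ t ⦂ A) → ∀ {γ γ′} → EqEnv Γ γ γ′ →
        Eq A (⟦ d ⟧ γ) (⟦ d ⟧ γ′)
Mid-⟦⟧ : {Γ : Ctx n} {t : Term n} (d : Γ ⊢ t ⦂ A) → ∀ {γ γ₁ γ₂} → MidEnv Γ γ γ₁ γ₂ →
         Mid A (⟦ d ⟧ γ) (⟦ d ⟧ γ₁) (⟦ d ⟧ γ₂)

Eq-⟦⟧ (⊢var {Γ = Γ} {x} eq) e = Eq-lookup Γ x eq e
Eq-⟦⟧ (⊢ƛ {Γ = Γ} d) e =
  (λ x → Eq-⟦⟧ d (x , e)) ,
  -- The bound variable becomes the distinguished one, with the outer environment constant.
  (λ m → Mid-⟦⟧ d (inj₁ (m , EqEnv-reflˡ Γ e , EqEnv-reflˡ Γ e))) ,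
  (λ m → Mid-⟦⟧ d (inj₁ (m , EqEnv-reflʳ Γ e , EqEnv-reflʳ Γ e)))
Eq-⟦⟧ (⊢· s d d′) e = proj₁ (Eq-⟦⟧ d (EqEnv-splitˡ s e)) (Eq-⟦⟧ d′ (EqEnv-splitʳ s e))
Eq-⟦⟧ ⊢𝟏 e = refl
Eq-⟦⟧ ⊢𝟎 e = refl
Eq-⟦⟧ ⊢coin e = refl
Eq-⟦⟧ (⊢if {A = A} s d d₁ d₂) e =
  Eq-mix A (Eq-⟦⟧ d (EqEnv-splitˡ s e)) (Eq-⟦⟧ d₁ (EqEnv-splitʳ s e)) (Eq-⟦⟧ d₂ (EqEnv-splitʳ s e))

Mid-⟦⟧ (⊢var {Γ = Γ} {x} eq) m = Mid-lookup Γ x eq m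
Mid-⟦⟧ (⊢ƛ {Γ = Γ} d) m =
  let e , e₁ , e₂ = MidEnv⇒EqEnv Γ m
  in (Eq-⟦⟧ (⊢ƛ d) e , Eq-⟦⟧ (⊢ƛ d) e₁ , Eq-⟦⟧ (⊢ƛ d) e₂) , λ x → Mid-⟦⟧ d (inj₂ ((x , x) , m))
Mid-⟦⟧ (⊢· {A = A} {B} s d d′) m with MidEnv-split s m
... | inj₁ (mˡ , e₁ , e₂) = Mid-app A B (Mid-⟦⟧ d mˡ) (Eq-⟦⟧ d′ e₁) (Eq-⟦⟧ d′ e₂)
... | inj₂ (mʳ , e₁ , e₂) = Mid-arg A B (Eq-⟦⟧ d e₁) (Eq-⟦⟧ d e₂) (Mid-⟦⟧ d′ mʳ)
Mid-⟦⟧ ⊢𝟏 m = refl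
Mid-⟦⟧ ⊢𝟎 m = refl
Mid-⟦⟧ ⊢coin m = refl
Mid-⟦⟧ (⊢if {Δ = Δ} {A = A} s d d₁ d₂) m with MidEnv-split s m
... | inj₁ (mˡ , e₁ , e₂) =
  -- The weight moves while both branches stay at the first environment; `Mid-resp` then carries the
  -- branches over to the other two environments.
  Mid-resp A (Eq-mix A refl (Eq-⟦⟧ d₁ e) (Eq-⟦⟧ d₂ e))
             (Eq-mix A refl (Eq-⟦⟧ d₁ e₁) (Eq-⟦⟧ d₂ e₁))
             (Eq-mix A refl (Eq-⟦⟧ d₁ e₂) (Eq-⟦⟧ d₂ e₂))
             (Mid-mix-weight A (Mid-⟦⟧ d mˡ) (Eq-⟦⟧ d₁ e) (Eq-⟦⟧ d₂ e))
  where e = EqEnv-reflˡ Δ e₁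
... | inj₂ (mʳ , e₁ , e₂) with Eq-⟦⟧ d e₁ | Eq-⟦⟧ d e₂
-- `Eq` at `𝔹` is equality of rationals, so the three weights become one and only the branches move.
...   | eq₁ | eq₂ rewrite sym eq₁ | sym eq₂ = Mid-mix A _ (Mid-⟦⟧ d₁ mʳ) (Mid-⟦⟧ d₂ mʳ)

-- Weakening, renaming and substitution

⨟-comm : Γ ⨟ Δ ≔ Θ → Δ ⨟ Γ ≔ Θ
⨟-comm []        = []
⨟-comm (none s)  = none (⨟-comm s)
⨟-comm (left s)  = right (⨟-comm s)
⨟-comm (right s) = left (⨟-comm s)

splitˡ-comm : (s : Γ ⨟ Δ ≔ Θ) (γ : Env Θ) → splitˡ (⨟-comm s) γ ≡ splitʳ s γ
splitˡ-comm []        _       = refl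
splitˡ-comm (none s)  γ       = splitˡ-comm s γ
splitˡ-comm (left s)  (_ , γ) = splitˡ-comm s γ
splitˡ-comm (right s) (a , γ) = cong (a ,_) (splitˡ-comm s γ)

splitʳ-comm : (s : Γ ⨟ Δ ≔ Θ) (γ : Env Θ) → splitʳ (⨟-comm s) γ ≡ splitˡ s γ
splitʳ-comm []        _       = refl
splitʳ-comm (none s)  γ       = splitʳ-comm s γ
splitʳ-comm (left s)  (a , γ) = cong (a ,_) (splitʳ-comm s γ)
splitʳ-comm (right s) (_ , γ) = splitʳ-comm s γ

-- Regroups (Γ₁, Γ₂), Δ as (Γ₁, Δ), Γ₂. The equations on environments are needed because denotations
-- depend on how a derivation splits its context.
record Exchange {Γ₁ Γ₂ Γ Δ Θ : Ctx n} (s : Γ₁ ⨟ Γ₂ ≔ Γ) (s′ : Γ ⨟ Δ ≔ Θ) : Set where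
  field
    {Ξ}   : Ctx n
    inner : Γ₁ ⨟ Δ ≔ Ξ
    outer : Ξ ⨟ Γ₂ ≔ Θ
    env₁  : ∀ γ → splitˡ inner (splitˡ outer γ) ≡ splitˡ s (splitˡ s′ γ)
    env₂  : ∀ γ → splitʳ outer γ ≡ splitʳ s (splitˡ s′ γ)
    env₃  : ∀ γ → splitʳ inner (splitˡ outer γ) ≡ splitʳ s′ γ

exchange : (s : Γ₁ ⨟ Γ₂ ≔ Γ) (s′ : Γ ⨟ Δ ≔ Θ) → Exchange s s′
exchange [] [] = record
  { inner = [] ; outer = [] ; env₁ = λ _ → refl ; env₂ = λ _ → refl ; env₃ = λ _ → refl }
exchange (none s) (none s′) = let open Exchange (exchange s s′) in record
  { inner = none inner ; outer = none outer ; env₁ = env₁ ; env₂ = env₂ ; env₃ = env₃ }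
exchange (none s) (right s′) = let open Exchange (exchange s s′) in record
  { inner = right inner ; outer = left outer
  ; env₁ = λ (_ , γ) → env₁ γ ; env₂ = λ (_ , γ) → env₂ γ ; env₃ = λ (a , γ) → cong (a ,_) (env₃ γ) }
exchange (left s) (left s′) = let open Exchange (exchange s s′) in record
  { inner = left inner ; outer = left outer
  ; env₁ = λ (a , γ) → cong (a ,_) (env₁ γ) ; env₂ = λ (_ , γ) → env₂ γ ; env₃ = λ (_ , γ) → env₃ γ }
exchange (right s) (left s′) = let open Exchange (exchange s s′) in record
  { inner = none inner ; outer = right outer
  ; env₁ = λ (_ , γ) → env₁ γ ; env₂ = λ (a , γ) → cong (a ,_) (env₂ γ) ; env₃ = λ (_ , γ) → env₃ γ }

lookup-⨟ : Γ ⨟ Δ ≔ Θ → (x : Fin n) → lookup Γ x ≡ just A → lookup Θ x ≡ just A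
lookup-⨟ (left s)  zero    eq = eq
lookup-⨟ (none s)  (suc x) eq = lookup-⨟ s x eq
lookup-⨟ (left s)  (suc x) eq = lookup-⨟ s x eq
lookup-⨟ (right s) (suc x) eq = lookup-⨟ s x eq

lookupᵉ-⨟ : {Γ Δ Θ : Ctx n} (s : Γ ⨟ Δ ≔ Θ) (x : Fin n) (eq : lookup Γ x ≡ just A) (γ : Env Θ) →
            lookupᵉ Θ x (lookup-⨟ s x eq) γ ≡ lookupᵉ Γ x eq (splitˡ s γ)
lookupᵉ-⨟ (left s)  zero    refl γ       = refl
lookupᵉ-⨟ (none s)  (suc x) eq   γ       = lookupᵉ-⨟ s x eq γ
lookupᵉ-⨟ (left s)  (suc x) eq   (_ , γ) = lookupᵉ-⨟ s x eq γ
lookupᵉ-⨟ (right s) (suc x) eq   (_ , γ) = lookupᵉ-⨟ s x eq γ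

-- Pointwise agreement is enough, since the denotation of any derivation already preserves
-- midpoints.
Eq-ƛ : {Γ : Ctx m} {Δ : Ctx n} {t : Term (suc m)} {r : Term (suc n)}
       (d : just A ∷ Γ ⊢ t ⦂ B) (e : just A ∷ Δ ⊢ r ⦂ B) → ∀ {γ δ} →
       EqEnv Γ γ γ → EqEnv Δ δ δ →
       (∀ {a b} → Eq A a b → Eq B (⟦ d ⟧ (a , γ)) (⟦ e ⟧ (b , δ))) →
       Eq (A ⇒ B) (⟦ ⊢ƛ d ⟧ γ) (⟦ ⊢ƛ e ⟧ δ)
Eq-ƛ d e γ≈ δ≈ pointwise =
  pointwise , proj₁ (proj₂ (Eq-⟦⟧ (⊢ƛ d) γ≈)) , proj₁ (proj₂ (Eq-⟦⟧ (⊢ƛ e) δ≈))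

-- Contracting a conditional frees the variables of its condition, and substitution retypes the
-- argument in a larger context. At each split all surplus variables go to the left subterm.
weaken : {t : Term n} → Γ ⨟ Δ ≔ Θ → Γ ⊢ t ⦂ A → Θ ⊢ t ⦂ A
weaken s (⊢var {x = x} eq) = ⊢var (lookup-⨟ s x eq)
weaken s (⊢ƛ d)            = ⊢ƛ (weaken (left s) d)
weaken s (⊢· s′ d e)       = let open Exchange (exchange s′ s) in ⊢· outer (weaken inner d) e
weaken s ⊢𝟏                = ⊢𝟏
weaken s ⊢𝟎                = ⊢𝟎
weaken s ⊢coin             = ⊢coin
weaken s (⊢if s′ d e f)    = let open Exchange (exchange s′ s) in ⊢if outer (weaken inner d) e f

-- Two related environments appear, rather than one, so that the induction passes under binders,
-- where functions are compared on related arguments. The analogues for renaming and substitution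
-- have the same form.
⟦weaken⟧ : {Γ Δ Θ : Ctx n} {t : Term n} (s : Γ ⨟ Δ ≔ Θ) (d : Γ ⊢ t ⦂ A) → ∀ {γ γ′} → EqEnv Θ γ γ′ →
           Eq A (⟦ weaken s d ⟧ γ) (⟦ d ⟧ (splitˡ s γ′))
⟦weaken⟧ s d@(⊢var {x = x} eq) {γ} {γ′} e
  rewrite lookupᵉ-⨟ s x eq γ = Eq-⟦⟧ d (EqEnv-splitˡ s e)
⟦weaken⟧ {Γ = Γ} {Θ = Θ} s (⊢ƛ d) e =
  Eq-ƛ (weaken (left s) d) d (EqEnv-reflˡ Θ e) (EqEnv-reflʳ Γ (EqEnv-splitˡ s e))
       (λ x → ⟦weaken⟧ (left s) d (x , e))
⟦weaken⟧ s (⊢· s′ d d′) {γ} {γ′} e with exchange s′ s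
... | record { inner = inner ; outer = outer ; env₁ = env₁ ; env₂ = env₂ }
  rewrite sym (env₁ γ′) | sym (env₂ γ′) =
  proj₁ (⟦weaken⟧ inner d (EqEnv-splitˡ outer e)) (Eq-⟦⟧ d′ (EqEnv-splitʳ outer e))
⟦weaken⟧ s ⊢𝟏 e = refl
⟦weaken⟧ s ⊢𝟎 e = refl
⟦weaken⟧ s ⊢coin e = refl
⟦weaken⟧ s (⊢if {A = A} s′ d d₁ d₂) {γ} {γ′} e with exchange s′ s
... | record { inner = inner ; outer = outer ; env₁ = env₁ ; env₂ = env₂ }
  rewrite sym (env₁ γ′) | sym (env₂ γ′) =
  Eq-mix A (⟦weaken⟧ inner d (EqEnv-splitˡ outer e))
           (Eq-⟦⟧ d₁ (EqEnv-splitʳ outer e)) (Eq-⟦⟧ d₂ (EqEnv-splitʳ outer e))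

⟦weaken⟧ʳ : {Γ Δ Θ : Ctx n} {t : Term n} (s : Γ ⨟ Δ ≔ Θ) (d : Δ ⊢ t ⦂ A) → ∀ {γ γ′} → EqEnv Θ γ γ′ →
            Eq A (⟦ weaken (⨟-comm s) d ⟧ γ) (⟦ d ⟧ (splitʳ s γ′))
⟦weaken⟧ʳ s d {γ′ = γ′} e rewrite sym (splitˡ-comm s γ′) = ⟦weaken⟧ (⨟-comm s) d e

-- Insertion of one variable in the context, below the bound ones.
data Ins : Ctx n → (Fin n → Fin (suc n)) → Ctx (suc n) → Set where
  here  : ∀ {a} {Γ : Ctx n} → Ins Γ suc (a ∷ Γ)
  there : ∀ {a ρ} {Γ : Ctx n} {Θ} → Ins Γ ρ Θ → Ins (a ∷ Γ) (extᵣ ρ) (a ∷ Θ)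

drop : ∀ {ρ} {Γ : Ctx n} {Θ} → Ins Γ ρ Θ → Env Θ → Env Γ
drop (here {a = nothing})  γ       = γ
drop (here {a = just _})   (_ , γ) = γ
drop (there {a = nothing} i) γ       = drop i γ
drop (there {a = just _} i)  (a , γ) = a , drop i γ

EqEnv-drop : ∀ {ρ} {Γ : Ctx n} {Θ} (i : Ins Γ ρ Θ) → ∀ {γ γ′} → EqEnv Θ γ γ′ →
             EqEnv Γ (drop i γ) (drop i γ′)
EqEnv-drop (here {a = nothing})    e       = e
EqEnv-drop (here {a = just _})     (_ , e) = e
EqEnv-drop (there {a = nothing} i) e       = EqEnv-drop i e
EqEnv-drop (there {a = just _} i)  (x , e) = x , EqEnv-drop i e

lookup-ins : ∀ {ρ} {Γ : Ctx n} {Θ} → Ins Γ ρ Θ → ∀ x → lookup Γ x ≡ just A → lookup Θ (ρ x) ≡ just A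
lookup-ins here      x       eq = eq
lookup-ins (there i) zero    eq = eq
lookup-ins (there i) (suc x) eq = lookup-ins i x eq

lookupᵉ-ins : ∀ {ρ} {Γ : Ctx n} {Θ} (i : Ins Γ ρ Θ) x (eq : lookup Γ x ≡ just A) (γ : Env Θ) →
              lookupᵉ Θ (ρ x) (lookup-ins i x eq) γ ≡ lookupᵉ Γ x eq (drop i γ)
lookupᵉ-ins (here {a = nothing})    x       eq   γ       = refl
lookupᵉ-ins (here {a = just _})     x       eq   γ       = refl
lookupᵉ-ins (there {a = just _} i)  zero    refl γ       = refl
lookupᵉ-ins (there {a = nothing} i) (suc x) eq   γ       = lookupᵉ-ins i x eq γ
lookupᵉ-ins (there {a = just _} i)  (suc x) eq   (_ , γ) = lookupᵉ-ins i x eq γ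

record SplitIns {Γ₁ Γ₂ Γ : Ctx n} {ρ} {Θ} (s : Γ₁ ⨟ Γ₂ ≔ Γ) (i : Ins Γ ρ Θ) : Set where
  field
    {Θ₁ Θ₂} : Ctx (suc n)
    split   : Θ₁ ⨟ Θ₂ ≔ Θ
    ins₁    : Ins Γ₁ ρ Θ₁
    ins₂    : Ins Γ₂ ρ Θ₂
    env₁    : ∀ γ → drop ins₁ (splitˡ split γ) ≡ splitˡ s (drop i γ)
    env₂    : ∀ γ → drop ins₂ (splitʳ split γ) ≡ splitʳ s (drop i γ)

splitIns : ∀ {Γ₁ Γ₂ Γ : Ctx n} {ρ Θ} (s : Γ₁ ⨟ Γ₂ ≔ Γ) (i : Ins Γ ρ Θ) → SplitIns s i
splitIns s (here {a = nothing}) = record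
  { split = none s ; ins₁ = here ; ins₂ = here ; env₁ = λ _ → refl ; env₂ = λ _ → refl }
splitIns s (here {a = just _}) = record
  -- The inserted variable occurs in neither subterm, so the side that receives it is an arbitrary
  -- choice.
  { split = left s ; ins₁ = here ; ins₂ = here ; env₁ = λ _ → refl ; env₂ = λ _ → refl }
splitIns (none s) (there i) = let open SplitIns (splitIns s i) in record
  { split = none split ; ins₁ = there ins₁ ; ins₂ = there ins₂ ; env₁ = env₁ ; env₂ = env₂ }
splitIns (left s) (there i) = let open SplitIns (splitIns s i) in record
  { split = left split ; ins₁ = there ins₁ ; ins₂ = there ins₂
  ; env₁ = λ (a , γ) → cong (a ,_) (env₁ γ) ; env₂ = λ (_ , γ) → env₂ γ }
splitIns (right s) (there i) = let open SplitIns (splitIns s i) in record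
  { split = right split ; ins₁ = there ins₁ ; ins₂ = there ins₂
  ; env₁ = λ (_ , γ) → env₁ γ ; env₂ = λ (a , γ) → cong (a ,_) (env₂ γ) }

⊢rename : ∀ {Γ : Ctx n} {ρ Θ t} → Ins Γ ρ Θ → Γ ⊢ t ⦂ A → Θ ⊢ rename ρ t ⦂ A
⊢rename i (⊢var {x = x} eq) = ⊢var (lookup-ins i x eq)
⊢rename i (⊢ƛ d)            = ⊢ƛ (⊢rename (there i) d)
⊢rename i (⊢· s d e)        =
  let open SplitIns (splitIns s i) in ⊢· split (⊢rename ins₁ d) (⊢rename ins₂ e)
⊢rename i ⊢𝟏                = ⊢𝟏
⊢rename i ⊢𝟎                = ⊢𝟎
⊢rename i ⊢coin             = ⊢coin
⊢rename i (⊢if s d e f)     =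
  let open SplitIns (splitIns s i) in ⊢if split (⊢rename ins₁ d) (⊢rename ins₂ e) (⊢rename ins₂ f)

⟦rename⟧ : ∀ {Γ : Ctx n} {ρ Θ t} (i : Ins Γ ρ Θ) (d : Γ ⊢ t ⦂ A) → ∀ {γ γ′} → EqEnv Θ γ γ′ →
           Eq A (⟦ ⊢rename i d ⟧ γ) (⟦ d ⟧ (drop i γ′))
⟦rename⟧ i d@(⊢var {x = x} eq) {γ} e
  rewrite lookupᵉ-ins i x eq γ = Eq-⟦⟧ d (EqEnv-drop i e)
⟦rename⟧ {Γ = Γ} {Θ = Θ} i (⊢ƛ d) e =
  Eq-ƛ (⊢rename (there i) d) d (EqEnv-reflˡ Θ e) (EqEnv-reflʳ Γ (EqEnv-drop i e))
       (λ x → ⟦rename⟧ (there i) d (x , e))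
⟦rename⟧ i (⊢· s d d′) {γ′ = γ′} e with splitIns s i
... | record { split = s′ ; ins₁ = i₁ ; ins₂ = i₂ ; env₁ = env₁ ; env₂ = env₂ }
  rewrite sym (env₁ γ′) | sym (env₂ γ′) =
  proj₁ (⟦rename⟧ i₁ d (EqEnv-splitˡ s′ e)) (⟦rename⟧ i₂ d′ (EqEnv-splitʳ s′ e))
⟦rename⟧ i ⊢𝟏 e = refl
⟦rename⟧ i ⊢𝟎 e = refl
⟦rename⟧ i ⊢coin e = refl
⟦rename⟧ i (⊢if {A = A} s d d₁ d₂) {γ′ = γ′} e with splitIns s i
... | record { split = s′ ; ins₁ = i₁ ; ins₂ = i₂ ; env₁ = env₁ ; env₂ = env₂ }
  rewrite sym (env₁ γ′) | sym (env₂ γ′) =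
  Eq-mix A (⟦rename⟧ i₁ d (EqEnv-splitˡ s′ e))
           (⟦rename⟧ i₂ d₁ (EqEnv-splitʳ s′ e)) (⟦rename⟧ i₂ d₂ (EqEnv-splitʳ s′ e))

-- Substitution of one variable: typing, denotation and weight.

-- The weight of a term bounds the length of its weak head reductions.  The
-- branches of a conditional count by their maximum, since they share variables.
weight : Term n → ℕ
weight (var _)              = 0
weight (ƛ t)                = suc (weight t)
weight (t · r)              = suc (weight t ℕ.+ weight r)
weight 𝟏                    = 0
weight 𝟎                    = 0
weight (if t then u else v) = suc (weight t ℕ.+ (weight u ℕ.⊔ weight v))
weight coin                 = 1

weight-rename : (ρ : Fin m → Fin n) (t : Term m) → weight (rename ρ t) ≡ weight t
weight-rename ρ (var _) = refl
weight-rename ρ (ƛ t) = cong suc (weight-rename (extᵣ ρ) t)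
weight-rename ρ (t · r) = cong suc (cong₂ ℕ._+_ (weight-rename ρ t) (weight-rename ρ r))
weight-rename ρ 𝟏 = refl
weight-rename ρ 𝟎 = refl
weight-rename ρ (if t then u else v) =
  cong suc (cong₂ ℕ._+_ (weight-rename ρ t) (cong₂ ℕ._⊔_ (weight-rename ρ u) (weight-rename ρ v)))
weight-rename ρ coin = refl

-- Substitution for one variable below the bound ones; unused covers the
-- subterms to which the splits do not assign that variable.
data Sub : Ctx (suc n) → (Fin (suc n) → Term n) → Ctx n → Set where
  used   : ∀ {r} {Γ Δ Θ : Ctx n} → Γ ⨟ Δ ≔ Θ → Δ ⊢ r ⦂ A → Sub (just A ∷ Γ) (sub₀ r) Θ
  unused : ∀ {r} {Γ : Ctx n} → Sub (nothing ∷ Γ) (sub₀ r) Γ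
  there  : ∀ {a Γ σ} {Θ : Ctx n} → Sub Γ σ Θ → Sub (a ∷ Γ) (extₛ σ) (a ∷ Θ)

⟦_⟧ˢ : ∀ {Γ σ} {Θ : Ctx n} → Sub Γ σ Θ → Env Θ → Env Γ
⟦ used s d ⟧ˢ                 γ       = ⟦ d ⟧ (splitʳ s γ) , splitˡ s γ
⟦ unused ⟧ˢ                   γ       = γ
⟦ there {a = nothing} S ⟧ˢ    γ       = ⟦ S ⟧ˢ γ
⟦ there {a = just _} S ⟧ˢ     (a , γ) = a , ⟦ S ⟧ˢ γ

EqEnv-⟦⟧ˢ : ∀ {Γ σ} {Θ : Ctx n} (S : Sub Γ σ Θ) → ∀ {γ γ′} → EqEnv Θ γ γ′ →
            EqEnv Γ (⟦ S ⟧ˢ γ) (⟦ S ⟧ˢ γ′)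
EqEnv-⟦⟧ˢ (used s d)              e       = Eq-⟦⟧ d (EqEnv-splitʳ s e) , EqEnv-splitˡ s e
EqEnv-⟦⟧ˢ unused                  e       = e
EqEnv-⟦⟧ˢ (there {a = nothing} S) e       = EqEnv-⟦⟧ˢ S e
EqEnv-⟦⟧ˢ (there {a = just _} S)  (x , e) = x , EqEnv-⟦⟧ˢ S e

weightˢ : ∀ {Γ σ} {Θ : Ctx n} → Sub Γ σ Θ → ℕ
weightˢ (used {r = r} _ _) = weight r
weightˢ unused             = 0
weightˢ (there S)          = weightˢ S

record SplitSub {Γ₁ Γ₂ Γ : Ctx (suc n)} {σ Θ} (s : Γ₁ ⨟ Γ₂ ≔ Γ) (S : Sub Γ σ Θ) : Set where
  field
    {Θ₁ Θ₂} : Ctx n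
    split   : Θ₁ ⨟ Θ₂ ≔ Θ
    sub₁    : Sub Γ₁ σ Θ₁
    sub₂    : Sub Γ₂ σ Θ₂
    weights : weightˢ sub₁ ℕ.+ weightˢ sub₂ ≡ weightˢ S
    env₁    : ∀ γ → ⟦ sub₁ ⟧ˢ (splitˡ split γ) ≡ splitˡ s (⟦ S ⟧ˢ γ)
    env₂    : ∀ γ → ⟦ sub₂ ⟧ˢ (splitʳ split γ) ≡ splitʳ s (⟦ S ⟧ˢ γ)

splitSub : ∀ {Γ₁ Γ₂ Γ : Ctx (suc n)} {σ Θ} (s : Γ₁ ⨟ Γ₂ ≔ Γ) (S : Sub Γ σ Θ) → SplitSub s S
splitSub (left s) (used s′ d) = let open Exchange (exchange s s′) in record
  { split = outer ; sub₁ = used inner d ; sub₂ = unused ; weights = ℕ.+-identityʳ _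
  ; env₁ = λ γ → cong₂ _,_ (cong ⟦ d ⟧ (env₃ γ)) (env₁ γ) ; env₂ = env₂ }
-- `exchange` enlarges the left component, so the split is swapped before and after.
splitSub (right s) (used s′ d) = let open Exchange (exchange (⨟-comm s) s′) in record
  { split = ⨟-comm outer ; sub₁ = unused ; sub₂ = used inner d ; weights = refl
  ; env₁ = λ γ → trans (splitˡ-comm outer γ) (trans (env₂ γ) (splitʳ-comm s (splitˡ s′ γ)))
  ; env₂ = λ γ → cong₂ _,_
      (cong ⟦ d ⟧ (trans (cong (splitʳ inner) (splitʳ-comm outer γ)) (env₃ γ)))
      (trans (cong (splitˡ inner) (splitʳ-comm outer γ))
             (trans (env₁ γ) (splitˡ-comm s (splitˡ s′ γ)))) }
splitSub (none s) unused = record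
  { split = s ; sub₁ = unused ; sub₂ = unused ; weights = refl ; env₁ = λ _ → refl ; env₂ = λ _ → refl }
splitSub (none s) (there S) = let open SplitSub (splitSub s S) in record
  { split = none split ; sub₁ = there sub₁ ; sub₂ = there sub₂ ; weights = weights
  ; env₁ = env₁ ; env₂ = env₂ }
splitSub (left s) (there S) = let open SplitSub (splitSub s S) in record
  { split = left split ; sub₁ = there sub₁ ; sub₂ = there sub₂ ; weights = weights
  ; env₁ = λ (a , γ) → cong (a ,_) (env₁ γ) ; env₂ = λ (_ , γ) → env₂ γ }
splitSub (right s) (there S) = let open SplitSub (splitSub s S) in record
  { split = right split ; sub₁ = there sub₁ ; sub₂ = there sub₂ ; weights = weights
  ; env₁ = λ (_ , γ) → env₁ γ ; env₂ = λ (a , γ) → cong (a ,_) (env₂ γ) }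

⊢subst-var : ∀ {Γ σ} {Θ : Ctx n} → Sub Γ σ Θ → ∀ x → lookup Γ x ≡ just A → Θ ⊢ σ x ⦂ A
⊢subst-var (used s d) zero    refl = weaken (⨟-comm s) d
⊢subst-var (used s d) (suc x) eq   = ⊢var (lookup-⨟ s x eq)
⊢subst-var unused     (suc x) eq   = ⊢var eq
⊢subst-var (there S)  zero    eq   = ⊢var eq
⊢subst-var (there S)  (suc x) eq   = ⊢rename here (⊢subst-var S x eq)

⟦subst-var⟧ : ∀ {Γ σ} {Θ : Ctx n} (S : Sub Γ σ Θ) x (eq : lookup Γ x ≡ just A) → ∀ {γ γ′} →
              EqEnv Θ γ γ′ → Eq A (⟦ ⊢subst-var S x eq ⟧ γ) (lookupᵉ Γ x eq (⟦ S ⟧ˢ γ′))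
⟦subst-var⟧ (used s d) zero refl e = ⟦weaken⟧ʳ s d e
⟦subst-var⟧ (used {Γ = Γ} s d) (suc x) eq {γ} e
  rewrite lookupᵉ-⨟ s x eq γ = Eq-lookup Γ x eq (EqEnv-splitˡ s e)
⟦subst-var⟧ (unused {Γ = Γ}) (suc x) eq e = Eq-lookup Γ x eq e
⟦subst-var⟧ (there {a = just _} S) zero refl (x , _) = x
⟦subst-var⟧ {A = A} (there {a = nothing} {Θ = Θ} S) (suc x) eq e =
  Eq-trans A (⟦rename⟧ here (⊢subst-var S x eq) (EqEnv-reflˡ Θ e)) (⟦subst-var⟧ S x eq e)
⟦subst-var⟧ {A = A} (there {a = just B} {Θ = Θ} S) (suc x) eq e =
  Eq-trans A (⟦rename⟧ here (⊢subst-var S x eq) (EqEnv-reflˡ (just B ∷ Θ) e))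
             (⟦subst-var⟧ S x eq (proj₂ e))

⊢subst : ∀ {Γ σ t} {Θ : Ctx n} → Sub Γ σ Θ → Γ ⊢ t ⦂ A → Θ ⊢ subst σ t ⦂ A
⊢subst S (⊢var {x = x} eq) = ⊢subst-var S x eq
⊢subst S (⊢ƛ d)            = ⊢ƛ (⊢subst (there S) d)
⊢subst S (⊢· s d e)        =
  let open SplitSub (splitSub s S) in ⊢· split (⊢subst sub₁ d) (⊢subst sub₂ e)
⊢subst S ⊢𝟏                = ⊢𝟏
⊢subst S ⊢𝟎                = ⊢𝟎
⊢subst S ⊢coin             = ⊢coin
⊢subst S (⊢if s d e f)     =
  let open SplitSub (splitSub s S) in ⊢if split (⊢subst sub₁ d) (⊢subst sub₂ e) (⊢subst sub₂ f)

⟦subst⟧ : ∀ {Γ σ t} {Θ : Ctx n} (S : Sub Γ σ Θ) (d : Γ ⊢ t ⦂ A) → ∀ {γ γ′} → EqEnv Θ γ γ′ →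
          Eq A (⟦ ⊢subst S d ⟧ γ) (⟦ d ⟧ (⟦ S ⟧ˢ γ′))
⟦subst⟧ S (⊢var {x = x} eq) e = ⟦subst-var⟧ S x eq e
⟦subst⟧ {Γ = Γ} {Θ = Θ} S (⊢ƛ d) e =
  Eq-ƛ (⊢subst (there S) d) d (EqEnv-reflˡ Θ e) (EqEnv-reflʳ Γ (EqEnv-⟦⟧ˢ S e))
       (λ x → ⟦subst⟧ (there S) d (x , e))
⟦subst⟧ S (⊢· s d d′) {γ′ = γ′} e with splitSub s S
... | record { split = s′ ; sub₁ = S₁ ; sub₂ = S₂ ; env₁ = env₁ ; env₂ = env₂ }
  rewrite sym (env₁ γ′) | sym (env₂ γ′) =
  proj₁ (⟦subst⟧ S₁ d (EqEnv-splitˡ s′ e)) (⟦subst⟧ S₂ d′ (EqEnv-splitʳ s′ e))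
⟦subst⟧ S ⊢𝟏 e = refl
⟦subst⟧ S ⊢𝟎 e = refl
⟦subst⟧ S ⊢coin e = refl
⟦subst⟧ S (⊢if {A = A} s d d₁ d₂) {γ′ = γ′} e with splitSub s S
... | record { split = s′ ; sub₁ = S₁ ; sub₂ = S₂ ; env₁ = env₁ ; env₂ = env₂ }
  rewrite sym (env₁ γ′) | sym (env₂ γ′) =
  Eq-mix A (⟦subst⟧ S₁ d (EqEnv-splitˡ s′ e))
           (⟦subst⟧ S₂ d₁ (EqEnv-splitʳ s′ e)) (⟦subst⟧ S₂ d₂ (EqEnv-splitʳ s′ e))

weight-subst-var : ∀ {Γ σ} {Θ : Ctx n} (S : Sub Γ σ Θ) x → lookup Γ x ≡ just A →
                   weight (σ x) ℕ.≤ weightˢ S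
weight-subst-var (used s d) zero    eq = ℕ.≤-refl
weight-subst-var (used s d) (suc x) eq = ℕ.z≤n
weight-subst-var unused     (suc x) eq = ℕ.z≤n
weight-subst-var (there S)  zero    eq = ℕ.z≤n
weight-subst-var (there {σ = σ} S) (suc x) eq
  rewrite weight-rename suc (σ x) = weight-subst-var S x eq

-- Splits send the substituted term to one side only. A conditional may copy it into both branches,
-- but the maximum counts it once, as addition distributes over `⊔`.
weight-subst : ∀ {Γ σ t} {Θ : Ctx n} (S : Sub Γ σ Θ) → Γ ⊢ t ⦂ A →
               weight (subst σ t) ℕ.≤ weight t ℕ.+ weightˢ S
weight-subst S (⊢var {x = x} eq) = weight-subst-var S x eq
weight-subst S (⊢ƛ d) = ℕ.s≤s (weight-subst (there S) d)
weight-subst {σ = σ} S (⊢· {t = t} {r} s d e) with splitSub s S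
... | record { sub₁ = S₁ ; sub₂ = S₂ ; weights = weights } rewrite sym weights = ℕ.s≤s (begin
  weight (subst σ t) ℕ.+ weight (subst σ r)
    ≤⟨ ℕ.+-mono-≤ (weight-subst S₁ d) (weight-subst S₂ e) ⟩
  (weight t ℕ.+ weightˢ S₁) ℕ.+ (weight r ℕ.+ weightˢ S₂)
    ≡⟨ interchange ℕ.+-commutativeSemigroup (weight t) _ _ _ ⟩
  (weight t ℕ.+ weight r) ℕ.+ (weightˢ S₁ ℕ.+ weightˢ S₂) ∎)
  where open ℕ.≤-Reasoning
weight-subst S ⊢𝟏 = ℕ.z≤n
weight-subst S ⊢𝟎 = ℕ.z≤n
weight-subst S ⊢coin = ℕ.s≤s ℕ.z≤n
weight-subst {σ = σ} S (⊢if {t = t} {u} {v} s d e f) with splitSub s S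
... | record { sub₁ = S₁ ; sub₂ = S₂ ; weights = weights } rewrite sym weights = ℕ.s≤s (begin
  weight (subst σ t) ℕ.+ (weight (subst σ u) ℕ.⊔ weight (subst σ v))
    ≤⟨ ℕ.+-mono-≤ (weight-subst S₁ d) (ℕ.⊔-mono-≤ (weight-subst S₂ e) (weight-subst S₂ f)) ⟩
  (weight t ℕ.+ weightˢ S₁) ℕ.+ ((weight u ℕ.+ weightˢ S₂) ℕ.⊔ (weight v ℕ.+ weightˢ S₂))
    ≡⟨ cong ((weight t ℕ.+ weightˢ S₁) ℕ.+_) (ℕ.+-distribʳ-⊔ (weightˢ S₂) (weight u) (weight v)) ⟨
  (weight t ℕ.+ weightˢ S₁) ℕ.+ ((weight u ℕ.⊔ weight v) ℕ.+ weightˢ S₂)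
    ≡⟨ interchange ℕ.+-commutativeSemigroup (weight t) _ _ _ ⟩
  (weight t ℕ.+ (weight u ℕ.⊔ weight v)) ℕ.+ (weightˢ S₁ ℕ.+ weightˢ S₂) ∎)
  where open ℕ.≤-Reasoning

-- Reduction preserves types and denotations

-- Subject reduction and invariance of the denotation go together, since a denotation belongs to a
-- derivation. The two shapes are the deterministic rules and the coin, each closed under contexts.
data Sound {n} {Γ : Ctx n} {t A} (d : Γ ⊢ t ⦂ A) : Dist n → Set where
  one : ∀ {r} (e : Γ ⊢ r ⦂ A) → (∀ {γ} → EqEnv Γ γ γ → Eq A (⟦ d ⟧ γ) (⟦ e ⟧ γ)) →
        Sound d [ 1ℚ , r ]
  two : ∀ {r r′} (e : Γ ⊢ r ⦂ A) (e′ : Γ ⊢ r′ ⦂ A) →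
        (∀ {γ} → EqEnv Γ γ γ → Mid A (⟦ d ⟧ γ) (⟦ e ⟧ γ) (⟦ e′ ⟧ γ)) →
        Sound d ((½ , r) ∷ (½ , r′) ∷ [])

-- For a coin, every position uses its own form of affinity: pointwise midpoints under a binder and
-- in function position, `Mid-mix-weight` in a condition, and `Mid-mix` in a branch, the other
-- branch being a constant midpoint.
sound : {Γ : Ctx n} {t : Term n} {E : Dist n} (d : Γ ⊢ t ⦂ A) → t ⟹ E → Sound d E
sound {A = A} (⊢· s (⊢ƛ d) e) β =
  one (⊢subst (used s e) d) (λ γ≈ → Eq-sym A (⟦subst⟧ (used s e) d γ≈))
sound (⊢if {A = A} s ⊢𝟏 d₁ d₂) if-𝟏 =
  one (weaken (⨟-comm s) d₁) λ γ≈ →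
    Eq-trans A (mix-1 A (Eq-⟦⟧ d₁ (EqEnv-splitʳ s γ≈)) (Eq-⟦⟧ d₂ (EqEnv-splitʳ s γ≈)))
               (Eq-sym A (⟦weaken⟧ʳ s d₁ γ≈))
sound (⊢if {A = A} s ⊢𝟎 d₁ d₂) if-𝟎 =
  one (weaken (⨟-comm s) d₂) λ γ≈ →
    Eq-trans A (mix-0 A (Eq-⟦⟧ d₁ (EqEnv-splitʳ s γ≈)) (Eq-⟦⟧ d₂ (EqEnv-splitʳ s γ≈)))
               (Eq-sym A (⟦weaken⟧ʳ s d₂ γ≈))
sound ⊢coin coin = two ⊢𝟏 ⊢𝟎 (λ _ → refl)
sound (⊢ƛ d) (ξ-ƛ r) with sound d r
... | one e eq = one (⊢ƛ e) λ γ≈ →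
  Eq-ƛ d e γ≈ γ≈ λ x → Eq-trans _ (Eq-⟦⟧ d (x , γ≈)) (eq (Eq-reflʳ _ x , γ≈))
... | two e e′ mid = two (⊢ƛ e) (⊢ƛ e′) λ γ≈ →
  (Eq-⟦⟧ (⊢ƛ d) γ≈ , Eq-⟦⟧ (⊢ƛ e) γ≈ , Eq-⟦⟧ (⊢ƛ e′) γ≈) , λ x → mid (x , γ≈)
sound (⊢· s d d′) (ξ-·ˡ r) with sound d r
... | one e eq = one (⊢· s e d′) λ γ≈ →
  proj₁ (eq (EqEnv-splitˡ s γ≈)) (Eq-⟦⟧ d′ (EqEnv-splitʳ s γ≈))
... | two e e′ mid = two (⊢· s e d′) (⊢· s e′ d′) λ γ≈ →
  proj₂ (mid (EqEnv-splitˡ s γ≈)) (Eq-⟦⟧ d′ (EqEnv-splitʳ s γ≈))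
sound (⊢· s d d′) (ξ-·ʳ r) with sound d′ r
... | one e eq = one (⊢· s d e) λ γ≈ →
  proj₁ (Eq-⟦⟧ d (EqEnv-splitˡ s γ≈)) (eq (EqEnv-splitʳ s γ≈))
-- A coin is resolved before the argument is passed; the function preserves midpoints, so this
-- agrees with resolving it afterwards.
... | two e e′ mid = two (⊢· s d e) (⊢· s d e′) λ γ≈ →
  proj₁ (proj₂ (Eq-⟦⟧ d (EqEnv-splitˡ s γ≈))) (mid (EqEnv-splitʳ s γ≈))
sound (⊢if {A = A} s d d₁ d₂) (ξ-if r) with sound d r
... | one e eq = one (⊢if s e d₁ d₂) λ γ≈ →
  Eq-mix A (eq (EqEnv-splitˡ s γ≈)) (Eq-⟦⟧ d₁ (EqEnv-splitʳ s γ≈)) (Eq-⟦⟧ d₂ (EqEnv-splitʳ s γ≈))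
... | two e e′ mid = two (⊢if s e d₁ d₂) (⊢if s e′ d₁ d₂) λ γ≈ →
  Mid-mix-weight A (mid (EqEnv-splitˡ s γ≈))
    (Eq-⟦⟧ d₁ (EqEnv-splitʳ s γ≈)) (Eq-⟦⟧ d₂ (EqEnv-splitʳ s γ≈))
sound (⊢if {A = A} s d d₁ d₂) (ξ-then r) with sound d₁ r
... | one e eq = one (⊢if s d e d₂) λ γ≈ →
  Eq-mix A refl (eq (EqEnv-splitʳ s γ≈)) (Eq-⟦⟧ d₂ (EqEnv-splitʳ s γ≈))
... | two e e′ mid = two (⊢if s d e d₂) (⊢if s d e′ d₂) λ γ≈ →
  Mid-mix A _ (mid (EqEnv-splitʳ s γ≈)) (Mid-refl A (Eq-⟦⟧ d₂ (EqEnv-splitʳ s γ≈)))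
sound (⊢if {A = A} s d d₁ d₂) (ξ-else r) with sound d₂ r
... | one e eq = one (⊢if s d d₁ e) λ γ≈ →
  Eq-mix A refl (Eq-⟦⟧ d₁ (EqEnv-splitʳ s γ≈)) (eq (EqEnv-splitʳ s γ≈))
... | two e e′ mid = two (⊢if s d d₁ e) (⊢if s d d₁ e′) λ γ≈ →
  Mid-mix A _ (Mid-refl A (Eq-⟦⟧ d₁ (EqEnv-splitʳ s γ≈))) (mid (EqEnv-splitʳ s γ≈))

-- Typed distributions and expected payoffs.

reducts⊢ : ∀ p {t E D} {d : [] ⊢ t ⦂ A} → Sound d E → TypedDist A D → TypedDist A (scale p E ++ D)
reducts⊢ p (one e _)    ds = e ∷ ds
reducts⊢ p (two e e′ _) ds = e ∷ e′ ∷ ds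

⟶ᵈ⊢ : ∀ {D D′} → TypedDist A D → D ⟶ᵈ D′ → TypedDist A D′
⟶ᵈ⊢ (d ∷ ds) (here {p = p} r) = reducts⊢ p (sound d r) ds
⟶ᵈ⊢ (d ∷ ds) (there s)        = d ∷ ⟶ᵈ⊢ ds s

⟶ᵈ*⊢ : ∀ {D D′} → TypedDist A D → Star _⟶ᵈ_ D D′ → TypedDist A D′
⟶ᵈ*⊢ ds ε        = ds
⟶ᵈ*⊢ ds (s ◅ ss) = ⟶ᵈ*⊢ (⟶ᵈ⊢ ds s) ss

-- The expectation of the payoff that is x on 𝟏 and y on 𝟎.
expect : ∀ {D} → ℚ → ℚ → TypedDist 𝔹 D → ℚ
expect                   x y []       = 0ℚ
expect {D = (p , _) ∷ _} x y (d ∷ ds) = p * mix 𝔹 (⟦ d ⟧ tt) x y + expect x y ds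

expect-reducts : ∀ x y p {t E D} {d : [] ⊢ t ⦂ 𝔹} (r : Sound d E) (ds : TypedDist 𝔹 D) →
  expect x y (reducts⊢ p r ds) ≡ p * mix 𝔹 (⟦ d ⟧ tt) x y + expect x y ds
expect-reducts x y p (one e eq) ds rewrite eq tt | ℚ.*-identityʳ p = refl
expect-reducts x y p (two e e′ mid) ds rewrite mid tt =
  solve 6 (λ p q r x y z →
             (p :* con ½) :* (q :* x :+ (con 1ℚ :- q) :* y) :+
             ((p :* con ½) :* (r :* x :+ (con 1ℚ :- r) :* y) :+ z) :=
             p :* ((con ½ :* q :+ con ½ :* r) :* x :+ (con 1ℚ :- (con ½ :* q :+ con ½ :* r)) :* y) :+ z)
          refl p (⟦ e ⟧ tt) (⟦ e′ ⟧ tt) x y (expect x y ds)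

expect-⟶ᵈ : ∀ x y {D D′} (ds : TypedDist 𝔹 D) (s : D ⟶ᵈ D′) → expect x y (⟶ᵈ⊢ ds s) ≡ expect x y ds
expect-⟶ᵈ x y (d ∷ ds) (here {p = p} r) = expect-reducts x y p (sound d r) ds
expect-⟶ᵈ x y {(p , _) ∷ _} (d ∷ ds) (there s) =
  cong (p * mix 𝔹 (⟦ d ⟧ tt) x y +_) (expect-⟶ᵈ x y ds s)

expect-⟶ᵈ* : ∀ x y {D D′} (ds : TypedDist 𝔹 D) (ss : Star _⟶ᵈ_ D D′) →
             expect x y (⟶ᵈ*⊢ ds ss) ≡ expect x y ds
expect-⟶ᵈ* x y ds ε        = refl
expect-⟶ᵈ* x y ds (s ◅ ss) = trans (expect-⟶ᵈ* x y (⟶ᵈ⊢ ds s) ss) (expect-⟶ᵈ x y ds s)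

data IsBool {n} : Term n → Set where
  𝟏 : IsBool 𝟏
  𝟎 : IsBool 𝟎

BoolDist : Dist n → Set
BoolDist = All (λ (_ , b) → IsBool b)

-- Replaces the equality test by multiplication with the indicator `prob [ 1ℚ , r ] t`.
prob-∷ : ∀ p (r : Term n) D t → prob ((p , r) ∷ D) t ≡ p * prob [ 1ℚ , r ] t + prob D t
prob-∷ p r D t with r ≟ t
... | yes _ = cong (_+ prob D t) (solve 1 (λ p → p := p :* (con 1ℚ :+ con 0ℚ)) refl p)
... | no  _ = solve 2 (λ p z → z := p :* con 0ℚ :+ z) refl p (prob D t)

-- The payoff is the indicator of `t`, evaluated at `𝟏` and at `𝟎`. This treats uniformly the terms
-- `t` that are not booleans, for which it vanishes.
prob-expect : ∀ t {D} (ds : TypedDist 𝔹 D) → BoolDist D →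
              prob D t ≡ expect (prob [ 1ℚ , 𝟏 ] t) (prob [ 1ℚ , 𝟎 ] t) ds
prob-expect t []         []       = refl
prob-expect t {(p , _) ∷ D} (⊢𝟏 ∷ ds) (𝟏 ∷ bs) =
  trans (prob-∷ p 𝟏 D t)
    (cong₂ _+_ (cong (p *_) (sym (mix-1 𝔹 {b = prob [ 1ℚ , 𝟎 ] t} refl refl))) (prob-expect t ds bs))
prob-expect t {(p , _) ∷ D} (⊢𝟎 ∷ ds) (𝟎 ∷ bs) =
  trans (prob-∷ p 𝟎 D t)
    (cong₂ _+_ (cong (p *_) (sym (mix-0 𝔹 {prob [ 1ℚ , 𝟏 ] t} refl refl))) (prob-expect t ds bs))

boolDist-unique : ∀ {t F₁ F₂} → [] ⊢ t ⦂ 𝔹 → t ↠ F₁ → t ↠ F₂ → BoolDist F₁ → BoolDist F₂ → F₁ ∼ F₂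
boolDist-unique {t} {F₁} {F₂} d r₁ r₂ bs₁ bs₂ b = begin
  prob F₁ b                ≡⟨ prob-expect b (⟶ᵈ*⊢ ds r₁) bs₁ ⟩
  expect x y (⟶ᵈ*⊢ ds r₁) ≡⟨ expect-⟶ᵈ* x y ds r₁ ⟩
  expect x y ds            ≡⟨ expect-⟶ᵈ* x y ds r₂ ⟨
  expect x y (⟶ᵈ*⊢ ds r₂) ≡⟨ prob-expect b (⟶ᵈ*⊢ ds r₂) bs₂ ⟨
  prob F₂ b                ∎
  where
  open ≡-Reasoning
  x = prob [ 1ℚ , 𝟏 ] b
  y = prob [ 1ℚ , 𝟎 ] b
  ds : TypedDist 𝔹 [ 1ℚ , t ]
  ds = d ∷ []

-- Closure properties of the reduction of distributions

scale-scale : ∀ p q (E : Dist n) → scale (p * q) E ≡ scale p (scale q E)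
scale-scale p q []            = refl
scale-scale p q ((r , t) ∷ E) = cong₂ _∷_ (cong (_, t) (ℚ.*-assoc p q r)) (scale-scale p q E)

mapᵈ-scale : ∀ (f : Term m → Term n) p E → scale p (mapᵈ f E) ≡ mapᵈ f (scale p E)
mapᵈ-scale f p []      = refl
mapᵈ-scale f p (_ ∷ E) = cong (_ ∷_) (mapᵈ-scale f p E)

⟶ᵈ-scale : ∀ p {D D′ : Dist n} → D ⟶ᵈ D′ → scale p D ⟶ᵈ scale p D′
⟶ᵈ-scale p (here {p = q} {E = E} {D = D} r)
  rewrite map-++ (map₁ (p *_)) (scale q E) D | sym (scale-scale p q E) = here r
⟶ᵈ-scale p (there s) = there (⟶ᵈ-scale p s)

⟶ᵈ-++ˡ : ∀ X {D D′ : Dist n} → D ⟶ᵈ D′ → X ++ D ⟶ᵈ X ++ D′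
⟶ᵈ-++ˡ []      s = s
⟶ᵈ-++ˡ (_ ∷ X) s = there (⟶ᵈ-++ˡ X s)

⟶ᵈ-++ʳ : ∀ X {D D′ : Dist n} → D ⟶ᵈ D′ → D ++ X ⟶ᵈ D′ ++ X
⟶ᵈ-++ʳ X (here {p = p} {E = E} {D = D} r) rewrite ++-assoc (scale p E) D X = here r
⟶ᵈ-++ʳ X (there s) = there (⟶ᵈ-++ʳ X s)

⟹-⟨⟩ : ∀ C {t E} → t ⟹ E → C ⟨ t ⟩ ⟹ mapᵈ (C ⟨_⟩) E
⟹-⟨⟩ ◊ {E = E} r = ≡.subst (_ ⟹_) (sym (map-id E)) r
⟹-⟨⟩ (app C v _) {E = E} r = ≡.subst (_ ⟹_) (sym (map-∘ E)) (ξ-·ˡ (⟹-⟨⟩ C r))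

⟶ᵈ-⟨⟩ : ∀ C {D D′} → D ⟶ᵈ D′ → mapᵈ (C ⟨_⟩) D ⟶ᵈ mapᵈ (C ⟨_⟩) D′
⟶ᵈ-⟨⟩ C (here {p = p} {E = E} {D = D} r)
  rewrite map-++ (map₂ (C ⟨_⟩)) (scale p E) D | sym (mapᵈ-scale (C ⟨_⟩) p E) = here (⟹-⟨⟩ C r)
⟶ᵈ-⟨⟩ C (there s) = there (⟶ᵈ-⟨⟩ C s)

-- The separate evaluations are run one after another inside the list, the finished ones being kept
-- as a prefix.
evaluates⇒⟶ᵈ* : ∀ {C D F} → Evaluates C D F → Star _⟶ᵈ_ (mapᵈ (C ⟨_⟩) D) F
evaluates⇒⟶ᵈ* [] = ε
evaluates⇒⟶ᵈ* {C} (cons {p} {t} {D} {E} {F} r _ ev) =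
  head ◅◅ gmap (scale p E ++_) (⟶ᵈ-++ˡ (scale p E)) (evaluates⇒⟶ᵈ* ev)
  where
  X = mapᵈ (C ⟨_⟩) D
  head : Star _⟶ᵈ_ ((p , C ⟨ t ⟩) ∷ X) (scale p E ++ X)
  -- The evaluation starts from probability `1ℚ`, so scaling it by `p` starts from `p * 1ℚ`.
  head = ≡.subst (λ q → Star _⟶ᵈ_ ((q , C ⟨ t ⟩) ∷ X) (scale p E ++ X)) (ℚ.*-identityʳ p)
           (gmap (λ Y → scale p Y ++ X) (⟶ᵈ-++ʳ X ∘ ⟶ᵈ-scale p) r)

-- Normalisation

data Value {n} : Term n → Set where
  ƛ_ : ∀ t → Value (ƛ t)
  𝟏  : Value 𝟏
  𝟎  : Value 𝟎

Lighter : Term n → Dist n → Set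
Lighter t = All (λ (_ , r) → weight r ℕ.< weight t)

-- Only weak head redexes are contracted. The subterms visited on the way are again closed, because
-- the empty context splits only into empty ones, and each contraction lowers the weight.
progress : ∀ {t} → [] ⊢ t ⦂ A → Value t ⊎ ∃ λ E → t ⟹ E × Lighter t E
progress (⊢ƛ d) = inj₁ (ƛ _)
progress ⊢𝟏     = inj₁ 𝟏
progress ⊢𝟎     = inj₁ 𝟎
progress ⊢coin  = inj₂ (_ , coin , ℕ.s≤s ℕ.z≤n ∷ ℕ.s≤s ℕ.z≤n ∷ [])
progress (⊢· [] d e) with progress d
progress (⊢· [] (⊢ƛ d) e) | inj₁ _ =
  -- The application and the abstraction each count one, so the bound of `weight-subst` is met with
  -- one unit to spare.
  inj₂ (_ , β , ℕ.s≤s (ℕ.m≤n⇒m≤1+n (weight-subst (used [] e) d)) ∷ [])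
... | inj₂ (_ , r , l) = inj₂ (_ , ξ-·ˡ r , map⁺ (All.map (λ lt → ℕ.s≤s (ℕ.+-monoˡ-< _ lt)) l))
progress (⊢if [] d d₁ d₂) with progress d
progress (⊢if [] ⊢𝟏 d₁ d₂) | inj₁ _ = inj₂ (_ , if-𝟏 , ℕ.s≤s (ℕ.m≤m⊔n _ _) ∷ [])
progress (⊢if [] ⊢𝟎 d₁ d₂) | inj₁ _ = inj₂ (_ , if-𝟎 , ℕ.s≤s (ℕ.m≤n⊔m _ _) ∷ [])
... | inj₂ (_ , r , l) = inj₂ (_ , ξ-if r , map⁺ (All.map (λ lt → ℕ.s≤s (ℕ.+-monoˡ-< _ lt)) l))

IsBool⇒Normal : ∀ {b : Term n} → IsBool b → Normal b
IsBool⇒Normal 𝟏 _ _ ()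
IsBool⇒Normal 𝟎 _ _ ()

Normalises : Term 0 → Set
Normalises t = ∃ λ E → t ↠ E × BoolDist E

evaluate : ∀ C {D} → All (λ (_ , t) → Normalises (C ⟨ t ⟩)) D → ∃ λ F → Evaluates C D F × BoolDist F
evaluate C []                  = [] , [] , []
evaluate C ((E , r , bs) ∷ ns) =
  let F , ev , cs = evaluate C ns
  in _ , cons r (All.map IsBool⇒Normal bs) ev , ++⁺ (map⁺ bs) cs

-- Well-founded recursion on weight; at type `𝔹` the closed values are the two booleans.
-- `normaliseAll` receives the accessibility of the smaller weights as an argument, which keeps the
-- recursion structural.
normalise : ∀ {t} → [] ⊢ t ⦂ 𝔹 → Acc ℕ._<_ (weight t) → Normalises t
normaliseAll : ∀ {D k} → TypedDist 𝔹 D → All (λ (_ , r) → weight r ℕ.< k) D →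
               (∀ {j} → j ℕ.< k → Acc ℕ._<_ j) → All (λ (_ , r) → Normalises r) D

normalise d ac with progress d
normalise ⊢𝟏 _ | inj₁ _ = _ , ε , 𝟏 ∷ []
normalise ⊢𝟎 _ | inj₁ _ = _ , ε , 𝟎 ∷ []
normalise d (acc rec) | inj₂ (E , r , l) =
  let ds = ≡.subst (TypedDist 𝔹) start (⟶ᵈ⊢ (d ∷ []) (here {p = 1ℚ} r))
      -- The trivial context `◊` lets `evaluate` join the normalisations of all the reducts into one
      -- reduction.
      F , ev , bs = evaluate ◊ (normaliseAll ds l rec)
  in F , ≡.subst (_ ⟶ᵈ_) start (here r) ◅ ≡.subst (λ D → Star _⟶ᵈ_ D F) (map-id E) (evaluates⇒⟶ᵈ* ev) , bs
  where
  start : scale 1ℚ E ++ [] ≡ E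
  start = trans (++-identityʳ _) (trans (map-cong (λ (p , t) → cong (_, t) (ℚ.*-identityˡ p)) E) (map-id E))

normaliseAll []       []       rec = []
normaliseAll (d ∷ ds) (l ∷ ls) rec = normalise d (rec l) ∷ normaliseAll ds ls rec

theorem1 : ∀ {A : Type} {t : Term 0} {D₁ D₂ : Dist 0} → [] ⊢ t ⦂ A → t ↠ D₁ → t ↠ D₂ → D₁ ≡[ A ] D₂
theorem1 {A} {t} d r₁ r₂ = record
  { typedˡ = ⟶ᵈ*⊢ (d ∷ []) r₁
  ; typedʳ = ⟶ᵈ*⊢ (d ∷ []) r₂
  ; equiv  = λ C C⦂A →
      let eval : ∀ {D} → t ↠ D → ∃ λ F → Evaluates C D F × BoolDist F
          -- Entries of a reduct of `t` keep the type `A`, so plugging them into `C` gives closed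
          -- booleans, which normalise.
          eval r = evaluate C (All.map (λ e → normalise (C⦂A _ e) (<-wellFounded _)) (⟶ᵈ*⊢ (d ∷ []) r))
          F₁ , ev₁ , bs₁ = eval r₁
          F₂ , ev₂ , bs₂ = eval r₂
          -- The reduction of `t` is replayed under `C` and followed by the evaluations, so that
          -- both final distributions come from the single term `C ⟨ t ⟩`.
          plug : ∀ {D F} → t ↠ D → Evaluates C D F → C ⟨ t ⟩ ↠ F
          plug r ev = gmap (mapᵈ (C ⟨_⟩)) (⟶ᵈ-⟨⟩ C) r ◅◅ evaluates⇒⟶ᵈ* ev
      in F₁ , F₂ , ev₁ , ev₂ , boolDist-unique (C⦂A t d) (plug r₁ ev₁) (plug r₂ ev₂) bs₁ bs₂
  }
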